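{- For all positive integers $m$ and $k$, $$\begin{aligned} &(-1)^m\zeta\left(\bar1,\{1\}_{m-1},3,\{1\}_{k-1}\right)+(-1)^k\zeta\left(\bar1,\{1\}_{k-1},3,\{1\}_{m-1}\right)\\ &=\frac{(-1)^{m+1}}{m!}(\ln2)^m\,\zeta\left(\bar3,\{1\}_{k-1}\right)+\frac{(-1)^{k+1}}{k!}(\ln2)^k\,\zeta\left(\bar3,\{1\}_{m-1}\right)+\zeta\left(\bar2,\{1\}_{m-1}\right)\zeta\left(\bar2,\{1\}_{k-1}\right)\\ &\quad+(-1)^{m+1}\sum_{i=1}^{m-1}\frac{(\ln2)^i}{i!}\,\zeta\left(\bar1,\{1\}_{m-i-1},3,\{1\}_{k-1}\right)+(-1)^{k+1}\sum_{i=1}^{k-1}\frac{(\ln2)^i}{i!}\,\zeta\left(\bar1,\{1\}_{k-i-1},3,\{1\}_{m-1}\right). \end{aligned}$$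
   Context: Notation. $\{1\}_r$ denotes the string of $r$ entries equal to $1$ (empty if $r=0$). For positive integers $s_1,\dots,s_r$, $\zeta(s_1,\dots,s_r):=\lim_{n\to\infty}\sum_{n\ge k_1>\cdots>k_r\ge1}\frac{1}{k_1^{s_1}\cdots k_r^{s_r}}$. A bar over an entry $s_j$ means that the factor $(-1)^{k_j}$ is inserted in the summand; e.g. $\zeta(\bar1,\{1\}_{m-1},3,\{1\}_{k-1})=\lim_{n\to\infty}\sum_{n\ge k_1>\cdots>k_{m+k}\ge1}\frac{(-1)^{k_1}}{k_1\cdots k_m\,k_{m+1}^3\,k_{m+2}\cdots k_{m+k}}$. Sums over empty ranges are $0$. -}

module Defs where

open import Data.Nat.Base as ℕ using (ℕ; zero; suc; _!)
import Data.Nat.Properties as ℕ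
open import Data.Nat.Properties using (_!≢0)
open import Data.Integer.Base using (+[1+_])
import Data.Integer.Base as ℤ
import Data.Integer.Properties as ℤ
open import Data.Rational.Base as ℚ using (ℚ; 0ℚ; 1ℚ; ½; ∣_∣; mkℚ; toℚᵘ; positive; nonNegative)
import Data.Rational.Properties as ℚ
import Data.Rational.Unnormalised.Base as ℚᵘ
import Data.Rational.Unnormalised.Properties as ℚᵘ
open import Data.Rational.Solver using (module +-*-Solver)
open import Algebra.Definitions.RawSemiring ℚ.+-*-rawSemiring as ℚ^ using ()
open import Data.Empty using (⊥)
open import Data.Unit.Base using (⊤)
open import Data.List.Base using (List; []; _∷_; replicate)
open import Data.Product.Base using (∃; _×_; _,_; proj₁; proj₂)
open import Relation.Nullary using (yes; no; contradiction; contradiction-irr)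
open import Relation.Binary.PropositionalEquality

-- Real numbers: Cauchy sequences of rationals.  A value of type ℝ stands
-- for the limit of its sequence, so wrapping a rational sequence with its
-- Cauchy property is taking its limit.

Cauchy : (ℕ → ℚ) → Set
Cauchy x = ∀ ε → 0ℚ ℚ.< ε → ∃ λ N → ∀ m n → N ℕ.≤ m → N ℕ.≤ n → ∣ x m ℚ.- x n ∣ ℚ.< ε

record ℝ : Set where
  constructor lim
  field
    seq    : ℕ → ℚ
    cauchy : Cauchy seq
open ℝ

infix 4 _≈_

_≈_ : ℝ → ℝ → Set
x ≈ y = ∀ ε → 0ℚ ℚ.< ε → ∃ λ N → ∀ n → N ℕ.≤ n → ∣ seq x n ℚ.- seq y n ∣ ℚ.< ε

∑< : ℕ → (ℕ → ℚ) → ℚ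
∑< zero    f = 0ℚ
∑< (suc n) f = ∑< n f ℚ.+ f n

-- plain s is the entry s, and bar s is the entry s with a bar.
data Entry : Set where
  plain bar : (s : ℕ) .{{_ : ℕ.NonZero s}} → Entry

factor : Entry → (k : ℕ) .{{_ : ℕ.NonZero k}} → ℚ
factor (plain s) k = (ℤ.+ 1 ℚ./ k) ℚ^.^ s
factor (bar s)   k = (ℚ.- 1ℚ) ℚ^.^ k ℚ.* (ℤ.+ 1 ℚ./ k) ℚ^.^ s

-- partial (s₁ ∷ … ∷ sᵣ ∷ []) n sums over n ≥ k₁ > ⋯ > kᵣ ≥ 1.
-- The summation variable is j = k₁ - 1, which bounds k₂.
partial : List Entry → ℕ → ℚ
partial []       n = 1ℚ
partial (e ∷ es) n = ∑< n λ j → factor e (suc j) ℚ.* partial es j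

-- The strings for which the limit exists: the leading entry is not an
-- unbarred 1.
Admissible : List Entry → Set
Admissible (plain (suc (suc _)) ∷ _) = ⊤
Admissible (bar _ ∷ _)               = ⊤
Admissible _                         = ⊥

-- The right Riemann sum (1/n) Σ_{j=1}^{n} 1/(1 + j/n) of ∫₁² dt/t for n
-- intervals of equal length, with the factor 1/n cancelled.
riemann-1/t : ℕ → ℚ
riemann-1/t n = ∑< n λ j → ℤ.+ 1 ℚ./ suc (n ℕ.+ j)

module Convergence where
  open import Data.Rational.Base
    using (_+_; _*_; _-_; -_; _≤_; _<_)
  open ℚ.≤-Reasoning
  open +-*-Solver using (solve; con; _:=_; _:+_; _:*_; _:-_; :-_)

  *-monoˡ : ∀ {a b c} → 0ℚ ≤ a → b ≤ c → a * b ≤ a * c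
  *-monoˡ {a} 0≤a b≤c = ℚ.*-monoˡ-≤-nonNeg a {{nonNegative 0≤a}} b≤c

  *-monoʳ : ∀ {a b c} → 0ℚ ≤ a → b ≤ c → b * a ≤ c * a
  *-monoʳ {a} 0≤a b≤c = ℚ.*-monoʳ-≤-nonNeg a {{nonNegative 0≤a}} b≤c

  0≤* : ∀ {a b} → 0ℚ ≤ a → 0ℚ ≤ b → 0ℚ ≤ a * b
  0≤* {a} {b} 0≤a 0≤b = subst (_≤ a * b) (ℚ.*-zeroʳ a) (*-monoˡ 0≤a 0≤b)

  0<* : ∀ {a b} → 0ℚ < a → 0ℚ < b → 0ℚ < a * b
  0<* {a} {b} 0<a 0<b =
    subst (_< a * b) (ℚ.*-zeroʳ a) (ℚ.*-monoʳ-<-pos a {{positive 0<a}} 0<b)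

  *-mono : ∀ {a b c d} → 0ℚ ≤ a → 0ℚ ≤ d → a ≤ b → c ≤ d → a * c ≤ b * d
  *-mono 0≤a 0≤d a≤b c≤d = ℚ.≤-trans (*-monoˡ 0≤a c≤d) (*-monoʳ 0≤d a≤b)

  ∣*∣-mono : ∀ a b {A B} → ∣ a ∣ ≤ A → ∣ b ∣ ≤ B → ∣ a * b ∣ ≤ A * B
  ∣*∣-mono a b {A} {B} p q = subst (_≤ A * B) (sym (ℚ.∣p*q∣≡∣p∣*∣q∣ a b))
    (*-mono (ℚ.0≤∣p∣ a) (ℚ.≤-trans (ℚ.0≤∣p∣ b) q) p q)

  ∣+∣-mono : ∀ a b {A B} → ∣ a ∣ ≤ A → ∣ b ∣ ≤ B → ∣ a + b ∣ ≤ A + B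
  ∣+∣-mono a b p q = ℚ.≤-trans (ℚ.∣p+q∣≤∣p∣+∣q∣ a b) (ℚ.+-mono-≤ p q)

  ∣-∣-mono : ∀ a b {A B} → ∣ a ∣ ≤ A → ∣ b ∣ ≤ B → ∣ a - b ∣ ≤ A + B
  ∣-∣-mono a b p q = ℚ.≤-trans (ℚ.∣p-q∣≤∣p∣+∣q∣ a b) (ℚ.+-mono-≤ p q)

  0≤p-q : ∀ {p q} → q ≤ p → 0ℚ ≤ p - q
  0≤p-q {p} {q} q≤p = subst (_≤ p - q) (ℚ.+-inverseʳ q) (ℚ.+-monoˡ-≤ (- q) q≤p)

  ∣p-q∣≡∣q-p∣ : ∀ p q → ∣ p - q ∣ ≡ ∣ q - p ∣
  ∣p-q∣≡∣q-p∣ p q = trans (sym (ℚ.∣-p∣≡∣p∣ (p - q)))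
    (cong ∣_∣ (solve 2 (λ p q → :- (p :- q) := q :- p) refl p q))

  ½-positive : 0ℚ < ½
  ½-positive = ℚ.positive⁻¹ ½

  0≤½ : 0ℚ ≤ ½
  0≤½ = ℚ.<⇒≤ ½-positive

  0≤1 : 0ℚ ≤ 1ℚ
  0≤1 = ℚ.nonNegative⁻¹ 1ℚ

  nat : ℕ → ℚ
  nat n = ℤ.+ n ℚ./ 1

  recip : ℕ → ℚ
  recip n = ℤ.+ 1 ℚ./ suc n

  nat-suc : ∀ n → nat (suc n) ≡ 1ℚ + nat n
  nat-suc n = ℚ.toℚᵘ-injective (go)
    where
    go : toℚᵘ (nat (suc n)) ℚᵘ.≃ toℚᵘ (1ℚ + nat n)
    go = ℚᵘ.≃-trans (ℚ.toℚᵘ-fromℚᵘ (ℚᵘ.mkℚᵘ (ℤ.+ suc n) 0))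
      (ℚᵘ.≃-sym (ℚᵘ.≃-trans (ℚ.toℚᵘ-homo-+ 1ℚ (nat n))
        (ℚᵘ.≃-trans (ℚᵘ.+-congʳ (toℚᵘ 1ℚ) (ℚ.toℚᵘ-fromℚᵘ (ℚᵘ.mkℚᵘ (ℤ.+ n) 0)))
          (ℚᵘ.*≡* (cong (ℤ._* ℤ.+ 1) (cong (λ k → ℤ.+ 1 ℤ.+ k) (ℤ.*-identityʳ (ℤ.+ n))))))))

  recip-nat : ∀ n → recip n * nat (suc n) ≡ 1ℚ
  recip-nat n = ℚ.toℚᵘ-injective (ℚᵘ.≃-trans (ℚ.toℚᵘ-homo-* (recip n) (nat (suc n)))
    (ℚᵘ.≃-trans
      (ℚᵘ.*-cong (ℚ.toℚᵘ-fromℚᵘ (ℚᵘ.mkℚᵘ (ℤ.+ 1) n)) (ℚ.toℚᵘ-fromℚᵘ (ℚᵘ.mkℚᵘ (ℤ.+ suc n) 0)))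
      (ℚᵘ.*≡* (cong ℤ.+_ (trans (ℕ.*-identityʳ _) (trans (ℕ.*-identityˡ (suc n))
        (sym (trans (ℕ.*-identityˡ _) (ℕ.*-identityʳ (suc n))))))))))

  0≤nat : ∀ n → 0ℚ ≤ nat n
  0≤nat n = ℚ.nonNegative⁻¹ (nat n) {{ℚ.normalize-nonNeg n 1}}

  0≤recip : ∀ n → 0ℚ ≤ recip n
  0≤recip n = ℚ.nonNegative⁻¹ (recip n) {{ℚ.normalize-nonNeg 1 (suc n)}}

  recip≤1 : ∀ n → recip n ≤ 1ℚ
  recip≤1 n = begin
    recip n              ≡⟨ ℚ.*-identityʳ (recip n) ⟨
    recip n * 1ℚ         ≤⟨ *-monoˡ (0≤recip n) 1≤ ⟩
    recip n * nat (suc n) ≡⟨ recip-nat n ⟩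
    1ℚ                   ∎
    where
    1≤ : 1ℚ ≤ nat (suc n)
    1≤ = subst₂ _≤_ (ℚ.+-identityʳ 1ℚ) (sym (nat-suc n)) (ℚ.+-monoʳ-≤ 1ℚ (0≤nat n))

  recip-diff : ∀ n → recip n - recip (suc n) ≡ recip n * recip (suc n)
  recip-diff n = begin-equality
    a - b                                     ≡⟨ cong₂ _-_ (ℚ.*-identityʳ a) (ℚ.*-identityʳ b) ⟨
    a * 1ℚ - b * 1ℚ                           ≡⟨ cong₂ (λ u v → a * u - b * v) (recip-nat (suc n)) (recip-nat n) ⟨
    a * (b * nat (suc (suc n))) - b * (a * x) ≡⟨ cong (λ u → a * (b * u) - b * (a * x)) (nat-suc (suc n)) ⟩
    a * (b * (1ℚ + x)) - b * (a * x)          ≡⟨ solve 3 (λ a b x → a :* (b :* (con 1ℚ :+ x)) :- b :* (a :* x) := a :* b) refl a b x ⟩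
    a * b                                     ∎
    where
    a = recip n
    b = recip (suc n)
    x = nat (suc n)

  recip-anti : ∀ n → recip (suc n) ≤ recip n
  recip-anti n = begin
    b           ≡⟨ ℚ.+-identityʳ b ⟨
    b + 0ℚ      ≤⟨ ℚ.+-monoʳ-≤ b (0≤* (0≤recip n) (0≤recip (suc n))) ⟩
    b + a * b   ≡⟨ cong (b +_) (recip-diff n) ⟨
    b + (a - b) ≡⟨ solve 2 (λ a b → b :+ (a :- b) := a) refl a b ⟩
    a           ∎
    where
    a = recip n
    b = recip (suc n)

  Null : (ℕ → ℚ) → Set
  Null w = ∀ ε → 0ℚ < ε → ∃ λ N → w N < ε

  recip-null : Null recip
  recip-null ε@(mkℚ +[1+ n ] d _) _ = suc d , ℚ.<-≤-trans decreasing bound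
    where
    decreasing : recip (suc d) < recip d
    decreasing = begin-strict
      b           ≡⟨ ℚ.+-identityʳ b ⟨
      b + 0ℚ      <⟨ ℚ.+-monoʳ-< b (0<* 0<a (ℚ.positive⁻¹ b {{ℚ.normalize-pos 1 (suc (suc d))}})) ⟩
      b + a * b   ≡⟨ cong (b +_) (recip-diff d) ⟨
      b + (a - b) ≡⟨ solve 2 (λ a b → b :+ (a :- b) := a) refl a b ⟩
      a           ∎
      where
      a = recip d
      b = recip (suc d)
      0<a : 0ℚ < a
      0<a = ℚ.positive⁻¹ a {{ℚ.normalize-pos 1 (suc d)}}
    bound : recip d ≤ ε
    bound = ℚ.toℚᵘ-cancel-≤ (ℚᵘ.≤-respˡ-≃ (ℚᵘ.≃-sym (ℚ.toℚᵘ-fromℚᵘ (ℚᵘ.mkℚᵘ (ℤ.+ 1) d)))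
      (ℚᵘ.*≤* (ℤ.*-monoʳ-≤-nonNeg (ℤ.+ suc d) (ℤ.+≤+ (ℕ.s≤s (ℕ.z≤n {n}))))))
  recip-null (mkℚ (ℤ.+ 0) _ _) (ℚ.*<* 0<0) = contradiction 0<0 (ℤ.<-irrefl refl)
  recip-null (mkℚ (ℤ.-[1+ n ]) d _) (ℚ.*<* ())

  tail-bound⇒cauchy : ∀ (x w : ℕ → ℚ) K → Null w → 0ℚ < K →
    (∀ n k → ∣ x (n ℕ.+ k) - x n ∣ ≤ K * w n) → Cauchy x
  tail-bound⇒cauchy x w K w→0 0<K tail ε 0<ε = N , close
    where
    K>0 : ℚ.Positive (K + K)
    K>0 = positive (ℚ.+-mono-< 0<K 0<K)
    instance
      K≢0 : ℚ.NonZero (K + K)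
      K≢0 = ℚ.pos⇒nonZero (K + K) {{K>0}}
    δ = (ℚ.1/ (K + K)) * ε
    0<δ : 0ℚ < δ
    0<δ = 0<* (ℚ.positive⁻¹ (ℚ.1/ (K + K)) {{ℚ.1/pos⇒pos (K + K) {{K>0}}}}) 0<ε
    N = proj₁ (w→0 δ 0<δ)
    near : ∀ n → N ℕ.≤ n → ∣ x n - x N ∣ ≤ K * w N
    near n N≤n = subst (λ i → ∣ x i - x N ∣ ≤ K * w N) (ℕ.m+[n∸m]≡n N≤n) (tail N (n ℕ.∸ N))
    close : ∀ m n → N ℕ.≤ m → N ℕ.≤ n → ∣ x m - x n ∣ < ε
    close m n N≤m N≤n = begin-strict
      ∣ x m - x n ∣                     ≡⟨ cong ∣_∣ (solve 3 (λ a b c → a :- b := (a :- c) :- (b :- c)) refl (x m) (x n) (x N)) ⟩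
      ∣ (x m - x N) - (x n - x N) ∣     ≤⟨ ∣-∣-mono (x m - x N) (x n - x N) (near m N≤m) (near n N≤n) ⟩
      K * w N + K * w N                 ≡⟨ ℚ.*-distribʳ-+ (w N) K K ⟨
      (K + K) * w N                     <⟨ ℚ.*-monoʳ-<-pos (K + K) {{K>0}} (proj₂ (w→0 δ 0<δ)) ⟩
      (K + K) * δ                       ≡⟨ ℚ.*-assoc (K + K) (ℚ.1/ (K + K)) ε ⟨
      (K + K) * (ℚ.1/ (K + K)) * ε      ≡⟨ cong (_* ε) (ℚ.*-inverseʳ (K + K)) ⟩
      1ℚ * ε                            ≡⟨ ℚ.*-identityˡ ε ⟩
      ε                                 ∎

  telescope : ∀ (x w : ℕ → ℚ) K → 0ℚ ≤ K → (∀ n → 0ℚ ≤ w n) →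
    (∀ n → ∣ x (suc n) - x n ∣ ≤ K * (w n - w (suc n))) →
    ∀ n k → ∣ x (n ℕ.+ k) - x n ∣ ≤ K * w n
  telescope x w K 0≤K 0≤w step n k = begin
    ∣ x (n ℕ.+ k) - x n ∣     ≤⟨ go k ⟩
    K * (w n - w (n ℕ.+ k))   ≤⟨ *-monoˡ 0≤K (ℚ.+-monoʳ-≤ (w n) (ℚ.neg-antimono-≤ (0≤w (n ℕ.+ k)))) ⟩
    K * (w n - 0ℚ)            ≡⟨ cong (K *_) (ℚ.+-identityʳ (w n)) ⟩
    K * w n                   ∎
    where
    go : ∀ k → ∣ x (n ℕ.+ k) - x n ∣ ≤ K * (w n - w (n ℕ.+ k))
    go zero rewrite ℕ.+-identityʳ n | ℚ.+-inverseʳ (x n) | ℚ.+-inverseʳ (w n) | ℚ.*-zeroʳ K = ℚ.≤-refl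
    go (suc k) rewrite ℕ.+-suc n k = begin
      ∣ x (suc i) - x n ∣                     ≡⟨ cong ∣_∣ (solve 3 (λ a b c → a :- b := (a :- c) :+ (c :- b)) refl (x (suc i)) (x n) (x i)) ⟩
      ∣ (x (suc i) - x i) + (x i - x n) ∣     ≤⟨ ∣+∣-mono (x (suc i) - x i) (x i - x n) (step i) (go k) ⟩
      K * (w i - w (suc i)) + K * (w n - w i) ≡⟨ solve 4 (λ K a b c → K :* (a :- b) :+ K :* (c :- a) := K :* (c :- b)) refl K (w i) (w (suc i)) (w n) ⟩
      K * (w n - w (suc i))                   ∎
      where i = n ℕ.+ k

  -- w n is of order 1/√n, so w n - w (suc n) is of order 1/(n √n) and
  -- dominates 1/n² times any power of log n.

  w : ℕ → ℚ
  w zero    = 1ℚ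
  w (suc n) = w n * (1ℚ - ½ * recip (suc n))

  w-diff : ∀ n → w n - w (suc n) ≡ ½ * (w n * recip (suc n))
  w-diff n = solve 2 (λ a r → a :- a :* (con 1ℚ :- con ½ :* r) := con ½ :* (a :* r))
    refl (w n) (recip (suc n))

  0≤w : ∀ n → 0ℚ ≤ w n
  0≤w zero    = 0≤1
  0≤w (suc n) = 0≤* (0≤w n) (0≤p-q (begin
    ½ * recip (suc n) ≤⟨ *-monoˡ 0≤½ (recip≤1 (suc n)) ⟩
    ½ * 1ℚ            ≡⟨⟩
    ½                 ≤⟨ ℚ.*≤* (ℤ.+≤+ (ℕ.s≤s ℕ.z≤n)) ⟩
    1ℚ                ∎))

  w-anti : ∀ n → w (suc n) ≤ w n
  w-anti n = begin
    w (suc n)                   ≡⟨ ℚ.+-identityʳ (w (suc n)) ⟨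
    w (suc n) + 0ℚ              ≤⟨ ℚ.+-monoʳ-≤ (w (suc n)) (subst (0ℚ ≤_) (sym (w-diff n)) (0≤* 0≤½ (0≤* (0≤w n) (0≤recip (suc n))))) ⟩
    w (suc n) + (w n - w (suc n)) ≡⟨ solve 2 (λ a b → b :+ (a :- b) := a) refl (w n) (w (suc n)) ⟩
    w n                         ∎

  w-anti+ : ∀ n k → w (n ℕ.+ k) ≤ w n
  w-anti+ n zero    = ℚ.≤-reflexive (cong w (ℕ.+-identityʳ n))
  w-anti+ n (suc k) = ℚ.≤-trans (subst (λ i → w i ≤ w (n ℕ.+ k)) (sym (ℕ.+-suc n k)) (w-anti (n ℕ.+ k))) (w-anti+ n k)

  2ℚ 3ℚ : ℚ
  2ℚ = ℤ.+ 2 ℚ./ 1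
  3ℚ = ℤ.+ 3 ℚ./ 1

  w²-bound : ∀ n → w n * w n * (2ℚ * nat n + 3ℚ) ≤ 3ℚ
  w²-bound zero    = ℚ.≤-refl
  w²-bound (suc n) = begin
    w (suc n) * w (suc n) * (2ℚ * nat (suc n) + 3ℚ)
      ≡⟨ cong (λ u → w (suc n) * w (suc n) * (2ℚ * u + 3ℚ)) x≡ ⟩
    w (suc n) * w (suc n) * (2ℚ * (N - 1ℚ) + 3ℚ)
      ≡⟨ solve 3 (λ a ρ N → (a :* (con 1ℚ :- con ½ :* ρ)) :* (a :* (con 1ℚ :- con ½ :* ρ)) :* (con 2ℚ :* (N :- con 1ℚ) :+ con 3ℚ)
           := a :* a :* (con 2ℚ :* N :+ con 1ℚ :- con 2ℚ :* (ρ :* N) :- ρ :+ con ½ :* ρ :* (ρ :* N) :+ con ½ :* con ½ :* (ρ :* ρ)))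
           refl (w n) ρ N ⟩
    w n * w n * (2ℚ * N + 1ℚ - 2ℚ * (ρ * N) - ρ + ½ * ρ * (ρ * N) + ½ * ½ * (ρ * ρ))
      ≡⟨ cong (λ u → w n * w n * (2ℚ * N + 1ℚ - 2ℚ * u - ρ + ½ * ρ * u + ½ * ½ * (ρ * ρ))) (recip-nat (suc n)) ⟩
    w n * w n * (2ℚ * N + 1ℚ - 2ℚ * 1ℚ - ρ + ½ * ρ * 1ℚ + ½ * ½ * (ρ * ρ))
      ≤⟨ *-monoˡ (0≤* (0≤w n) (0≤w n)) inner ⟩
    w n * w n * (2ℚ * (N - 1ℚ - 1ℚ) + 3ℚ)
      ≡⟨ cong (λ u → w n * w n * (2ℚ * u + 3ℚ)) (sym y≡) ⟩
    w n * w n * (2ℚ * nat n + 3ℚ)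
      ≤⟨ w²-bound n ⟩
    3ℚ ∎
    where
    N = nat (suc (suc n))
    ρ = recip (suc n)
    pred≡ : ∀ i → nat i ≡ nat (suc i) - 1ℚ
    pred≡ i = trans (solve 1 (λ a → a := con 1ℚ :+ a :- con 1ℚ) refl (nat i)) (cong (_- 1ℚ) (sym (nat-suc i)))
    x≡ : nat (suc n) ≡ N - 1ℚ
    x≡ = pred≡ (suc n)
    y≡ : nat n ≡ N - 1ℚ - 1ℚ
    y≡ = trans (pred≡ n) (cong (_- 1ℚ) x≡)
    ρρ≤ρ : ½ * ½ * (ρ * ρ) ≤ ½ * ρ
    ρρ≤ρ = begin
      ½ * ½ * (ρ * ρ) ≤⟨ *-monoˡ (ℚ.nonNegative⁻¹ (½ * ½)) (*-monoˡ (0≤recip (suc n)) (recip≤1 (suc n))) ⟩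
      ½ * ½ * (ρ * 1ℚ) ≡⟨ cong (½ * ½ *_) (ℚ.*-identityʳ ρ) ⟩
      ½ * ½ * ρ       ≤⟨ *-monoʳ {ρ} {½ * ½} {½} (0≤recip (suc n)) (ℚ.*≤* (ℤ.+≤+ (ℕ.s≤s (ℕ.s≤s ℕ.z≤n)))) ⟩
      ½ * ρ           ∎
    inner : 2ℚ * N + 1ℚ - 2ℚ * 1ℚ - ρ + ½ * ρ * 1ℚ + ½ * ½ * (ρ * ρ) ≤ 2ℚ * (N - 1ℚ - 1ℚ) + 3ℚ
    inner = begin
      2ℚ * N + 1ℚ - 2ℚ * 1ℚ - ρ + ½ * ρ * 1ℚ + ½ * ½ * (ρ * ρ)
        ≤⟨ ℚ.+-monoʳ-≤ (2ℚ * N + 1ℚ - 2ℚ * 1ℚ - ρ + ½ * ρ * 1ℚ) ρρ≤ρ ⟩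
      2ℚ * N + 1ℚ - 2ℚ * 1ℚ - ρ + ½ * ρ * 1ℚ + ½ * ρ
        ≡⟨ solve 2 (λ N ρ → con 2ℚ :* N :+ con 1ℚ :- con 2ℚ :* con 1ℚ :- ρ :+ con ½ :* ρ :* con 1ℚ :+ con ½ :* ρ
             := con 2ℚ :* (N :- con 1ℚ :- con 1ℚ) :+ con 3ℚ) refl N ρ ⟩
      2ℚ * (N - 1ℚ - 1ℚ) + 3ℚ ∎

  w²≤ : ∀ n → w n * w n ≤ 3ℚ * recip n
  w²≤ n = begin
    w n * w n                     ≡⟨ ℚ.*-identityʳ (w n * w n) ⟨
    w n * w n * 1ℚ                ≤⟨ *-monoˡ (0≤* (0≤w n) (0≤w n)) 1≤ ⟩
    w n * w n * ((2ℚ * x + 3ℚ) * r) ≡⟨ ℚ.*-assoc (w n * w n) (2ℚ * x + 3ℚ) r ⟨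
    w n * w n * (2ℚ * x + 3ℚ) * r ≤⟨ *-monoʳ (0≤recip n) (w²-bound n) ⟩
    3ℚ * r                        ∎
    where
    x = nat n
    r = recip n
    1≤ : 1ℚ ≤ (2ℚ * x + 3ℚ) * r
    1≤ = begin
      1ℚ                            ≡⟨ recip-nat n ⟨
      r * nat (suc n)               ≡⟨ cong (r *_) (nat-suc n) ⟩
      r * (1ℚ + x)                  ≡⟨ ℚ.+-identityʳ (r * (1ℚ + x)) ⟨
      r * (1ℚ + x) + 0ℚ             ≤⟨ ℚ.+-monoʳ-≤ (r * (1ℚ + x)) (0≤* (0≤recip n) (ℚ.+-mono-≤ (ℚ.nonNegative⁻¹ 2ℚ) (0≤nat n))) ⟩
      r * (1ℚ + x) + r * (2ℚ + x)   ≡⟨ solve 2 (λ r x → r :* (con 1ℚ :+ x) :+ r :* (con 2ℚ :+ x) := (con 2ℚ :* x :+ con 3ℚ) :* r) refl r x ⟩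
      (2ℚ * x + 3ℚ) * r             ∎

  w-null : Null w
  w-null ε 0<ε = N , small
    where
    ⅓ : ℚ
    ⅓ = ℤ.+ 1 ℚ./ 3
    N<δ = recip-null (⅓ * (ε * ε)) (0<* (ℚ.positive⁻¹ ⅓) (0<* 0<ε 0<ε))
    N = proj₁ N<δ
    small : w N < ε
    small with w N ℚ.<? ε
    ... | yes p = p
    ... | no ¬p = contradiction (begin-strict
      ε * ε              ≤⟨ *-mono 0≤ε (0≤w N) (ℚ.≮⇒≥ ¬p) (ℚ.≮⇒≥ ¬p) ⟩
      w N * w N          ≤⟨ w²≤ N ⟩
      3ℚ * recip N       <⟨ ℚ.*-monoʳ-<-pos 3ℚ (proj₂ N<δ) ⟩
      3ℚ * (⅓ * (ε * ε)) ≡⟨ ℚ.*-assoc 3ℚ ⅓ (ε * ε) ⟨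
      1ℚ * (ε * ε)       ≡⟨ ℚ.*-identityˡ (ε * ε) ⟩
      ε * ε              ∎) (ℚ.<-irrefl refl)
      where 0≤ε = ℚ.<⇒≤ 0<ε

  v : ℕ → ℚ
  v n = w n * nat (suc n)

  0≤v : ∀ n → 0ℚ ≤ v n
  0≤v n = 0≤* (0≤w n) (0≤nat (suc n))

  v-suc : ∀ n → v (suc n) ≡ v n + ½ * w n
  v-suc n = begin-equality
    a * (1ℚ - ½ * ρ) * nat (suc (suc n)) ≡⟨ solve 3 (λ a ρ N → a :* (con 1ℚ :- con ½ :* ρ) :* N := a :* N :- con ½ :* a :* (ρ :* N)) refl a ρ (nat (suc (suc n))) ⟩
    a * nat (suc (suc n)) - ½ * a * (ρ * nat (suc (suc n)))
      ≡⟨ cong₂ (λ s t → a * s - ½ * a * t) (nat-suc (suc n)) (recip-nat (suc n)) ⟩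
    a * (1ℚ + x) - ½ * a * 1ℚ             ≡⟨ solve 2 (λ a x → a :* (con 1ℚ :+ x) :- con ½ :* a :* con 1ℚ := a :* x :+ con ½ :* a) refl a x ⟩
    a * x + ½ * a                         ∎
    where
    a = w n
    ρ = recip (suc n)
    x = nat (suc n)

  recip-v : ∀ n → recip n * v n ≡ w n
  recip-v n = begin-equality
    recip n * (w n * nat (suc n)) ≡⟨ solve 3 (λ r a x → r :* (a :* x) := a :* (r :* x)) refl (recip n) (w n) (nat (suc n)) ⟩
    w n * (recip n * nat (suc n)) ≡⟨ cong (w n *_) (recip-nat n) ⟩
    w n * 1ℚ                      ≡⟨ ℚ.*-identityʳ (w n) ⟩
    w n                           ∎

  recip^≤1 : ∀ n s → ∣ recip n ℚ^.^ s ∣ ≤ 1ℚ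
  recip^≤1 n zero    = ℚ.≤-refl
  recip^≤1 n (suc s) = subst (∣ recip n ℚ^.^ suc s ∣ ≤_) (ℚ.*-identityˡ 1ℚ)
    (∣*∣-mono (recip n) (recip n ℚ^.^ s) (subst (_≤ 1ℚ) (sym (ℚ.0≤p⇒∣p∣≡p (0≤recip n))) (recip≤1 n)) (recip^≤1 n s))

  recip^≤recip : ∀ n s → ∣ recip n ℚ^.^ suc s ∣ ≤ recip n
  recip^≤recip n s = subst (∣ recip n ℚ^.^ suc s ∣ ≤_) (ℚ.*-identityʳ (recip n))
    (∣*∣-mono (recip n) (recip n ℚ^.^ s) (ℚ.≤-reflexive (ℚ.0≤p⇒∣p∣≡p (0≤recip n))) (recip^≤1 n s))

  recip^≤recip² : ∀ n s → ∣ recip n ℚ^.^ suc (suc s) ∣ ≤ recip n * recip n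
  recip^≤recip² n s =
    ∣*∣-mono (recip n) (recip n ℚ^.^ suc s) (ℚ.≤-reflexive (ℚ.0≤p⇒∣p∣≡p (0≤recip n))) (recip^≤recip n s)

  ∣sign∣ : ∀ n → ∣ (- 1ℚ) ℚ^.^ n ∣ ≤ 1ℚ
  ∣sign∣ zero    = ℚ.≤-refl
  ∣sign∣ (suc n) = subst (∣ (- 1ℚ) ℚ^.^ suc n ∣ ≤_) (ℚ.*-identityˡ 1ℚ) (∣*∣-mono (- 1ℚ) ((- 1ℚ) ℚ^.^ n) ℚ.≤-refl (∣sign∣ n))

  signed : ∀ n a {A} → ∣ a ∣ ≤ A → ∣ (- 1ℚ) ℚ^.^ n * a ∣ ≤ A
  signed n a {A} p = subst (∣ (- 1ℚ) ℚ^.^ n * a ∣ ≤_) (ℚ.*-identityˡ A) (∣*∣-mono ((- 1ℚ) ℚ^.^ n) a (∣sign∣ n) p)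

  factor≤ : ∀ e n → ∣ factor e (suc n) ∣ ≤ recip n
  factor≤ (plain zero {{s}})    n = contradiction-irr s λ ()
  factor≤ (plain (suc s)) n = recip^≤recip n s
  factor≤ (bar zero {{s}})      n = contradiction-irr s λ ()
  factor≤ (bar (suc s))   n = signed (suc n) (recip n ℚ^.^ suc s) (recip^≤recip n s)

  const : List Entry → ℚ
  const []       = 1ℚ
  const (_ ∷ es) = const es + const es

  0<const : ∀ es → 0ℚ < const es
  0<const []       = ℚ.positive⁻¹ 1ℚ
  0<const (_ ∷ es) = ℚ.+-mono-< (0<const es) (0<const es)

  0≤const : ∀ es → 0ℚ ≤ const es
  0≤const es = ℚ.<⇒≤ (0<const es)

  1≤v : ∀ n → 1ℚ ≤ v n
  1≤v zero    = ℚ.≤-refl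
  1≤v (suc n) = begin
    1ℚ            ≡⟨ ℚ.+-identityʳ 1ℚ ⟨
    1ℚ + 0ℚ       ≤⟨ ℚ.+-mono-≤ (1≤v n) (0≤* 0≤½ (0≤w n)) ⟩
    v n + ½ * w n ≡⟨ v-suc n ⟨
    v (suc n)     ∎

  partial≤ : ∀ es n → ∣ partial es n ∣ ≤ const es * v n
  term≤    : ∀ e es n → ∣ factor e (suc n) * partial es n ∣ ≤ const es * w n

  term≤ e es n = begin
    ∣ factor e (suc n) * partial es n ∣ ≤⟨ ∣*∣-mono (factor e (suc n)) (partial es n) (factor≤ e n) (partial≤ es n) ⟩
    recip n * (C * v n)                 ≡⟨ solve 3 (λ r c v → r :* (c :* v) := c :* (r :* v)) refl (recip n) C (v n) ⟩
    C * (recip n * v n)                 ≡⟨ cong (C *_) (recip-v n) ⟩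
    C * w n                             ∎
    where C = const es

  partial≤ []       n = subst (1ℚ ≤_) (sym (ℚ.*-identityˡ (v n))) (1≤v n)
  partial≤ (e ∷ es) zero    = 0≤* (0≤const (e ∷ es)) (0≤v 0)
  partial≤ (e ∷ es) (suc n) = begin
    ∣ partial (e ∷ es) n + factor e (suc n) * partial es n ∣
      ≤⟨ ∣+∣-mono (partial (e ∷ es) n) (factor e (suc n) * partial es n) (partial≤ (e ∷ es) n) (term≤ e es n) ⟩
    (C + C) * v n + C * w n
      ≡⟨ solve 3 (λ C v w → (C :+ C) :* v :+ C :* w := (C :+ C) :* (v :+ con ½ :* w)) refl C (v n) (w n) ⟩
    (C + C) * (v n + ½ * w n)
      ≡⟨ cong ((C + C) *_) (v-suc n) ⟨
    (C + C) * v (suc n) ∎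
    where C = const es

  partial-step : ∀ es n → ∣ partial es (suc n) - partial es n ∣ ≤ const es * w n
  partial-step [] n = subst (0ℚ ≤_) (sym (ℚ.*-identityˡ (w n))) (0≤w n)
  partial-step (e ∷ es) n = begin
    ∣ p + t - p ∣     ≡⟨ cong ∣_∣ (solve 2 (λ p t → p :+ t :- p := t) refl p t) ⟩
    ∣ t ∣             ≤⟨ term≤ e es n ⟩
    C * w n           ≡⟨ ℚ.+-identityʳ (C * w n) ⟨
    C * w n + 0ℚ      ≤⟨ ℚ.+-monoʳ-≤ (C * w n) (0≤* (0≤const es) (0≤w n)) ⟩
    C * w n + C * w n ≡⟨ ℚ.*-distribʳ-+ (w n) C C ⟨
    (C + C) * w n     ∎
    where
    p = partial (e ∷ es) n
    t = factor e (suc n) * partial es n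
    C = const es

  recip≤2recip : ∀ n → recip n ≤ recip (suc n) + recip (suc n)
  recip≤2recip n = begin
    a           ≡⟨ solve 2 (λ a b → a := b :+ (a :- b)) refl a b ⟩
    b + (a - b) ≡⟨ cong (b +_) (recip-diff n) ⟩
    b + a * b   ≤⟨ ℚ.+-monoʳ-≤ b (*-monoʳ (0≤recip (suc n)) (recip≤1 n)) ⟩
    b + 1ℚ * b  ≡⟨ cong (b +_) (ℚ.*-identityˡ b) ⟩
    b + b       ∎
    where
    a = recip n
    b = recip (suc n)

  module _ (es : List Entry) where
    private
      C = const es
      4C = (C + C) + (C + C)

      0<4C : 0ℚ < 4C
      0<4C = ℚ.+-mono-< (0<const (plain 1 ∷ es)) (0<const (plain 1 ∷ es))

      w-diff-4C : ∀ n → 4C * (w n - w (suc n)) ≡ recip (suc n) * ((C + C) * w n)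
      w-diff-4C n = begin-equality
        4C * (w n - w (suc n))               ≡⟨ cong (4C *_) (w-diff n) ⟩
        4C * (½ * (w n * recip (suc n)))     ≡⟨ solve 3 (λ C w r → ((C :+ C) :+ (C :+ C)) :* (con ½ :* (w :* r)) := r :* ((C :+ C) :* w)) refl C (w n) (recip (suc n)) ⟩
        recip (suc n) * ((C + C) * w n)      ∎

    absolute : ∀ e → (∀ n → ∣ factor e (suc n) ∣ ≤ recip n * recip n) → Cauchy (partial (e ∷ es))
    absolute e f≤ = tail-bound⇒cauchy (partial (e ∷ es)) w 4C w-null 0<4C (telescope (partial (e ∷ es)) w 4C (ℚ.<⇒≤ 0<4C) 0≤w step)
      where
      step : ∀ n → ∣ partial (e ∷ es) (suc n) - partial (e ∷ es) n ∣ ≤ 4C * (w n - w (suc n))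
      step n = begin
        ∣ p + f * t - p ∣            ≡⟨ cong ∣_∣ (solve 2 (λ p t → p :+ t :- p := t) refl p (f * t)) ⟩
        ∣ f * t ∣                    ≤⟨ ∣*∣-mono f t (f≤ n) (partial≤ es n) ⟩
        a * a * (C * v n)            ≡⟨ solve 3 (λ a C v → a :* a :* (C :* v) := a :* (C :* (a :* v))) refl a C (v n) ⟩
        a * (C * (a * v n))          ≡⟨ cong (λ u → a * (C * u)) (recip-v n) ⟩
        a * (C * w n)                ≤⟨ *-monoʳ (0≤* (0≤const es) (0≤w n)) (recip≤2recip n) ⟩
        (b + b) * (C * w n)          ≡⟨ solve 3 (λ b C w → (b :+ b) :* (C :* w) := b :* ((C :+ C) :* w)) refl b C (w n) ⟩
        b * ((C + C) * w n)          ≡⟨ w-diff-4C n ⟨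
        4C * (w n - w (suc n))       ∎
        where
        p = partial (e ∷ es) n
        f = factor e (suc n)
        t = partial es n
        a = recip n
        b = recip (suc n)

    -- For the alternating series x with terms sₙ bₙ, the averaged sequence
    -- x n + ½ sₙ bₙ has the absolutely small differences ½ sₙ (bₙ - bₙ₊₁).
    alternating : Cauchy (partial (bar 1 ∷ es))
    alternating = tail-bound⇒cauchy x w (4C + C) w-null (ℚ.+-mono-< 0<4C (0<const es)) tail
      where
      x s b y : ℕ → ℚ
      x = partial (bar 1 ∷ es)
      s n = (- 1ℚ) ℚ^.^ suc n
      b n = recip n * partial es n
      y n = x n + ½ * (s n * b n)

      b≤ : ∀ n → ∣ b n ∣ ≤ C * w n
      b≤ n = subst (λ u → ∣ u * partial es n ∣ ≤ C * w n) (ℚ.*-identityʳ (recip n)) (term≤ (plain 1) es n)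

      b-step : ∀ n → ∣ b n - b (suc n) ∣ ≤ 4C * (w n - w (suc n))
      b-step n = begin
        ∣ r * t - ρ * t′ ∣               ≡⟨ cong ∣_∣ (solve 4 (λ r ρ t t′ → r :* t :- ρ :* t′ := (r :- ρ) :* t :- ρ :* (t′ :- t)) refl r ρ t t′) ⟩
        ∣ (r - ρ) * t - ρ * (t′ - t) ∣   ≡⟨ cong (λ u → ∣ u * t - ρ * (t′ - t) ∣) (recip-diff n) ⟩
        ∣ r * ρ * t - ρ * (t′ - t) ∣     ≡⟨ cong ∣_∣ (solve 4 (λ r ρ t d → r :* ρ :* t :- ρ :* d := ρ :* (r :* t :- d)) refl r ρ t (t′ - t)) ⟩
        ∣ ρ * (r * t - (t′ - t)) ∣       ≤⟨ ∣*∣-mono ρ (r * t - (t′ - t)) (ℚ.≤-reflexive (ℚ.0≤p⇒∣p∣≡p (0≤recip (suc n)))) (∣-∣-mono (r * t) (t′ - t) (b≤ n) (partial-step es n)) ⟩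
        ρ * (C * w n + C * w n)          ≡⟨ cong (ρ *_) (ℚ.*-distribʳ-+ (w n) C C) ⟨
        ρ * ((C + C) * w n)              ≡⟨ w-diff-4C n ⟨
        4C * (w n - w (suc n))           ∎
        where
        r = recip n
        ρ = recip (suc n)
        t = partial es n
        t′ = partial es (suc n)

      ½*≤ : ∀ {A} → 0ℚ ≤ A → ½ * A ≤ A
      ½*≤ {A} 0≤A = subst (½ * A ≤_) (ℚ.*-identityˡ A) (*-monoʳ {A} {½} {1ℚ} 0≤A (ℚ.*≤* (ℤ.+≤+ (ℕ.s≤s ℕ.z≤n))))

      y-step : ∀ n → ∣ y (suc n) - y n ∣ ≤ 4C * (w n - w (suc n))
      y-step n = begin
        ∣ y (suc n) - y n ∣
          ≡⟨ cong ∣_∣ (solve 5 (λ x s r t b′ →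
               ((x :+ s :* (r :* con 1ℚ) :* t) :+ con ½ :* ((con (- 1ℚ) :* s) :* b′)) :- (x :+ con ½ :* (s :* (r :* t)))
               := con ½ :* (s :* (r :* t :- b′)))
               refl (x n) (s n) (recip n) (partial es n) (b (suc n))) ⟩
        ∣ ½ * (s n * (b n - b (suc n))) ∣  ≤⟨ ∣*∣-mono ½ (s n * (b n - b (suc n))) ℚ.≤-refl (signed (suc n) (b n - b (suc n)) (b-step n)) ⟩
        ½ * (4C * (w n - w (suc n)))       ≤⟨ ½*≤ (ℚ.≤-trans (ℚ.0≤∣p∣ (b n - b (suc n))) (b-step n)) ⟩
        4C * (w n - w (suc n))             ∎

      tail : ∀ n k → ∣ x (n ℕ.+ k) - x n ∣ ≤ (4C + C) * w n
      tail n k = begin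
        ∣ x i - x n ∣
          ≡⟨ cong ∣_∣ (solve 4 (λ x x′ d d′ → x :- x′ := ((x :+ con ½ :* d) :- (x′ :+ con ½ :* d′)) :+ con ½ :* (d′ :- d))
               refl (x i) (x n) (s i * b i) (s n * b n)) ⟩
        ∣ (y i - y n) + ½ * (s n * b n - s i * b i) ∣
          ≤⟨ ∣+∣-mono (y i - y n) (½ * (s n * b n - s i * b i)) (telescope y w 4C (ℚ.<⇒≤ 0<4C) 0≤w y-step n k)
               (∣*∣-mono ½ (s n * b n - s i * b i) ℚ.≤-refl (∣-∣-mono (s n * b n) (s i * b i) (signed (suc n) (b n) (b≤ n))
                 (signed (suc i) (b i) (ℚ.≤-trans (b≤ i) (*-monoˡ (0≤const es) (w-anti+ n k)))))) ⟩
        4C * w n + ½ * (C * w n + C * w n)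
          ≡⟨ solve 2 (λ C w → ((C :+ C) :+ (C :+ C)) :* w :+ con ½ :* (C :* w :+ C :* w) := ((C :+ C) :+ (C :+ C) :+ C) :* w) refl C (w n) ⟩
        (4C + C) * w n ∎
        where i = n ℕ.+ k

  partial-cauchy : ∀ es → .(Admissible es) → Cauchy (partial es)
  partial-cauchy (plain zero ∷ _) ()
  partial-cauchy (plain (suc zero) ∷ _) ()
  partial-cauchy (plain (suc (suc s)) ∷ es) _ = absolute es (plain (suc (suc s))) λ n → recip^≤recip² n s
  partial-cauchy (bar zero {{s}} ∷ es) _ = contradiction-irr s λ ()
  partial-cauchy (bar (suc zero) ∷ es) _ = alternating es
  partial-cauchy (bar (suc (suc s)) ∷ es) _ =
    absolute es (bar (suc (suc s))) λ n → signed (suc n) (recip n ℚ^.^ suc (suc s)) (recip^≤recip² n s)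

  -- With H n = 1 + ⋯ + 1/n, riemann-1/t n = H (2n) - H n, so successive
  -- values differ by 1/(2n+1) - 1/(2n+2).

  H : ℕ → ℚ
  H n = ∑< n recip

  shifted-H : ∀ n k → ∑< k (λ j → recip (n ℕ.+ j)) ≡ H (n ℕ.+ k) - H n
  shifted-H n zero rewrite ℕ.+-identityʳ n = sym (ℚ.+-inverseʳ (H n))
  shifted-H n (suc k) rewrite ℕ.+-suc n k = trans (cong (_+ recip (n ℕ.+ k)) (shifted-H n k))
    (solve 3 (λ a b c → a :- b :+ c := a :+ c :- b) refl (H (n ℕ.+ k)) (H n) (recip (n ℕ.+ k)))

  recip-anti+ : ∀ n k → recip (n ℕ.+ k) ≤ recip n
  recip-anti+ n zero    = ℚ.≤-reflexive (cong recip (ℕ.+-identityʳ n))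
  recip-anti+ n (suc k) = ℚ.≤-trans
    (subst (λ i → recip i ≤ recip (n ℕ.+ k)) (sym (ℕ.+-suc n k)) (recip-anti (n ℕ.+ k))) (recip-anti+ n k)

  recip-double : ∀ n → recip n ≡ recip (suc (n ℕ.+ n)) + recip (suc (n ℕ.+ n))
  recip-double n = begin-equality
    a                     ≡⟨ ℚ.*-identityʳ a ⟨
    a * 1ℚ                ≡⟨ cong (a *_) (recip-nat (suc (n ℕ.+ n))) ⟨
    a * (b * nat (suc (suc (n ℕ.+ n)))) ≡⟨ cong (λ u → a * (b * u)) double ⟩
    a * (b * (x + x))     ≡⟨ solve 3 (λ a b x → a :* (b :* (x :+ x)) := b :* (a :* x) :+ b :* (a :* x)) refl a b x ⟩
    b * (a * x) + b * (a * x) ≡⟨ cong (λ u → b * u + b * u) (recip-nat n) ⟩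
    b * 1ℚ + b * 1ℚ       ≡⟨ cong (λ u → u + u) (ℚ.*-identityʳ b) ⟩
    b + b                 ∎
    where
    a = recip n
    b = recip (suc (n ℕ.+ n))
    x = nat (suc n)
    nat-+ : ∀ m n → nat (m ℕ.+ n) ≡ nat m + nat n
    nat-+ zero    n = sym (ℚ.+-identityˡ (nat n))
    nat-+ (suc m) n = trans (nat-suc (m ℕ.+ n)) (trans (cong (1ℚ +_) (nat-+ m n))
      (trans (sym (ℚ.+-assoc 1ℚ (nat m) (nat n))) (cong (_+ nat n) (sym (nat-suc m)))))
    double : nat (suc (suc (n ℕ.+ n))) ≡ x + x
    double = trans (cong (λ i → nat (suc i)) (sym (ℕ.+-suc n n))) (nat-+ (suc n) (suc n))

  riemann-step : ∀ n → riemann-1/t (suc n) - riemann-1/t n ≡ recip (n ℕ.+ n) - recip (suc (n ℕ.+ n))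
  riemann-step n = begin-equality
    riemann-1/t (suc n) - riemann-1/t n
      ≡⟨ cong₂ _-_ (trans (shifted-H (suc n) (suc n)) (cong (λ i → H i - H (suc n)) (cong suc (ℕ.+-suc n n)))) (shifted-H n n) ⟩
    (H (n ℕ.+ n) + a + b - (H n + recip n)) - (H (n ℕ.+ n) - H n)
      ≡⟨ cong (λ u → (H (n ℕ.+ n) + a + b - (H n + u)) - (H (n ℕ.+ n) - H n)) (recip-double n) ⟩
    (H (n ℕ.+ n) + a + b - (H n + (b + b))) - (H (n ℕ.+ n) - H n)
      ≡⟨ solve 4 (λ h k a b → (h :+ a :+ b :- (k :+ (b :+ b))) :- (h :- k) := a :- b) refl (H (n ℕ.+ n)) (H n) a b ⟩
    a - b ∎
    where
    a = recip (n ℕ.+ n)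
    b = recip (suc (n ℕ.+ n))

  riemann-cauchy : Cauchy riemann-1/t
  riemann-cauchy = tail-bound⇒cauchy riemann-1/t recip 1ℚ recip-null (ℚ.positive⁻¹ 1ℚ) (telescope riemann-1/t recip 1ℚ 0≤1 0≤recip step)
    where
    step : ∀ n → ∣ riemann-1/t (suc n) - riemann-1/t n ∣ ≤ 1ℚ * (recip n - recip (suc n))
    step n = begin
      ∣ riemann-1/t (suc n) - riemann-1/t n ∣ ≡⟨ cong ∣_∣ (trans (riemann-step n) (recip-diff (n ℕ.+ n))) ⟩
      ∣ a * b ∣                               ≡⟨ ℚ.0≤p⇒∣p∣≡p (0≤* (0≤recip (n ℕ.+ n)) (0≤recip (suc (n ℕ.+ n)))) ⟩
      a * b                                   ≤⟨ *-mono (0≤recip (n ℕ.+ n)) (0≤recip (suc n)) (recip-anti+ n n) (recip-anti+ (suc n) n) ⟩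
      recip n * recip (suc n)                 ≡⟨ recip-diff n ⟨
      recip n - recip (suc n)                 ≡⟨ ℚ.*-identityˡ (recip n - recip (suc n)) ⟨
      1ℚ * (recip n - recip (suc n))          ∎
      where
      a = recip (n ℕ.+ n)
      b = recip (suc (n ℕ.+ n))

  const-cauchy : ∀ q → Cauchy (λ _ → q)
  const-cauchy q ε 0<ε = 0 , λ _ _ _ _ → subst (λ u → ∣ u ∣ < ε) (sym (ℚ.+-inverseʳ q)) 0<ε

  neg-cauchy : ∀ x → Cauchy x → Cauchy (λ n → - x n)
  neg-cauchy x X ε 0<ε = proj₁ (X ε 0<ε) , λ m n N≤m N≤n →
    subst (_< ε) (trans (sym (ℚ.∣-p∣≡∣p∣ (x m - x n))) (cong ∣_∣ (ℚ.neg-distrib-+ (x m) (- x n))))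
      (proj₂ (X ε 0<ε) m n N≤m N≤n)

  +-cauchy : ∀ x y → Cauchy x → Cauchy y → Cauchy (λ n → x n + y n)
  +-cauchy x y X Y ε 0<ε = M ℕ.⊔ N , λ m n N≤m N≤n → begin-strict
    ∣ x m + y m - (x n + y n) ∣         ≡⟨ cong ∣_∣ (solve 4 (λ a b c d → a :+ b :- (c :+ d) := (a :- c) :+ (b :- d)) refl (x m) (y m) (x n) (y n)) ⟩
    ∣ (x m - x n) + (y m - y n) ∣       ≤⟨ ℚ.∣p+q∣≤∣p∣+∣q∣ (x m - x n) (y m - y n) ⟩
    ∣ x m - x n ∣ + ∣ y m - y n ∣       <⟨ ℚ.+-mono-< (proj₂ (X δ 0<δ) m n (ℕ.m⊔n≤o⇒m≤o M N N≤m) (ℕ.m⊔n≤o⇒m≤o M N N≤n))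
                                                     (proj₂ (Y δ 0<δ) m n (ℕ.m⊔n≤o⇒n≤o M N N≤m) (ℕ.m⊔n≤o⇒n≤o M N N≤n)) ⟩
    ½ * ε + ½ * ε                       ≡⟨ solve 1 (λ e → con ½ :* e :+ con ½ :* e := e) refl ε ⟩
    ε                                   ∎
    where
    δ = ½ * ε
    0<δ = 0<* ½-positive 0<ε
    M = proj₁ (X δ 0<δ)
    N = proj₁ (Y δ 0<δ)

  EventuallyBounded : (ℕ → ℚ) → Set
  EventuallyBounded x = ∃ λ N → ∃ λ B → 0ℚ < B × (∀ n → N ℕ.≤ n → ∣ x n ∣ ≤ B)

  eventually-bounded : ∀ x → Cauchy x → EventuallyBounded x
  eventually-bounded x X = N , B , 0<B , bound
    where
    0<1 = ℚ.positive⁻¹ 1ℚ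
    N = proj₁ (X 1ℚ 0<1)
    B = 1ℚ + ∣ x N ∣
    0<B : 0ℚ < B
    0<B = ℚ.+-mono-<-≤ 0<1 (ℚ.0≤∣p∣ (x N))
    bound : ∀ n → N ℕ.≤ n → ∣ x n ∣ ≤ B
    bound n N≤n = begin
      ∣ x n ∣               ≡⟨ cong ∣_∣ (solve 2 (λ a b → a := (a :- b) :+ b) refl (x n) (x N)) ⟩
      ∣ (x n - x N) + x N ∣ ≤⟨ ∣+∣-mono (x n - x N) (x N) (ℚ.<⇒≤ (proj₂ (X 1ℚ 0<1) n N N≤n ℕ.≤-refl)) ℚ.≤-refl ⟩
      B                     ∎

  *-cauchy : ∀ x y → Cauchy x → Cauchy y → Cauchy (λ n → x n * y n)
  *-cauchy x y X Y = bounded (eventually-bounded x X) (eventually-bounded y Y)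
    where
    bounded : EventuallyBounded x → EventuallyBounded y → Cauchy (λ n → x n * y n)
    bounded (M₁ , A , 0<A , x≤A) (N₁ , B , 0<B , y≤B) ε 0<ε = (M₁ ℕ.⊔ N₁) ℕ.⊔ (M₂ ℕ.⊔ N₂) , close
      where
      D = A + B
      D>0 : ℚ.Positive D
      D>0 = positive (ℚ.+-mono-< 0<A 0<B)
      instance
        D≢0 : ℚ.NonZero D
        D≢0 = ℚ.pos⇒nonZero D {{D>0}}
      δ = (ℚ.1/ D) * ε
      0<δ : 0ℚ < δ
      0<δ = 0<* (ℚ.positive⁻¹ (ℚ.1/ D) {{ℚ.1/pos⇒pos D {{D>0}}}}) 0<ε
      M₂ = proj₁ (X δ 0<δ)
      N₂ = proj₁ (Y δ 0<δ)
      close : ∀ m n → (M₁ ℕ.⊔ N₁) ℕ.⊔ (M₂ ℕ.⊔ N₂) ℕ.≤ m → (M₁ ℕ.⊔ N₁) ℕ.⊔ (M₂ ℕ.⊔ N₂) ℕ.≤ n →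
        ∣ x m * y m - x n * y n ∣ < ε
      close m n ≤m ≤n = begin-strict
        ∣ x m * y m - x n * y n ∣                 ≡⟨ cong ∣_∣ (solve 4 (λ a b c d → a :* b :- c :* d := a :* (b :- d) :+ d :* (a :- c)) refl (x m) (y m) (x n) (y n)) ⟩
        ∣ x m * (y m - y n) + y n * (x m - x n) ∣ ≤⟨ ∣+∣-mono (x m * (y m - y n)) (y n * (x m - x n))
                                                       (∣*∣-mono (x m) (y m - y n) (x≤A m (ℕ.m⊔n≤o⇒m≤o M₁ N₁ (l ≤m))) ℚ.≤-refl)
                                                       (∣*∣-mono (y n) (x m - x n) (y≤B n (ℕ.m⊔n≤o⇒n≤o M₁ N₁ (l ≤n))) ℚ.≤-refl) ⟩
        A * ∣ y m - y n ∣ + B * ∣ x m - x n ∣     <⟨ ℚ.+-mono-<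
                                                       (ℚ.*-monoʳ-<-pos A {{positive 0<A}} (proj₂ (Y δ 0<δ) m n (ℕ.m⊔n≤o⇒n≤o M₂ N₂ (r ≤m)) (ℕ.m⊔n≤o⇒n≤o M₂ N₂ (r ≤n))))
                                                       (ℚ.*-monoʳ-<-pos B {{positive 0<B}} (proj₂ (X δ 0<δ) m n (ℕ.m⊔n≤o⇒m≤o M₂ N₂ (r ≤m)) (ℕ.m⊔n≤o⇒m≤o M₂ N₂ (r ≤n)))) ⟩
        A * δ + B * δ                             ≡⟨ ℚ.*-distribʳ-+ δ A B ⟨
        D * ((ℚ.1/ D) * ε)                        ≡⟨ ℚ.*-assoc D (ℚ.1/ D) ε ⟨
        D * (ℚ.1/ D) * ε                          ≡⟨ cong (_* ε) (ℚ.*-inverseʳ D) ⟩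
        1ℚ * ε                                    ≡⟨ ℚ.*-identityˡ ε ⟩
        ε                                         ∎
        where
        l : ∀ {i} → (M₁ ℕ.⊔ N₁) ℕ.⊔ (M₂ ℕ.⊔ N₂) ℕ.≤ i → M₁ ℕ.⊔ N₁ ℕ.≤ i
        l = ℕ.m⊔n≤o⇒m≤o (M₁ ℕ.⊔ N₁) (M₂ ℕ.⊔ N₂)
        r : ∀ {i} → (M₁ ℕ.⊔ N₁) ℕ.⊔ (M₂ ℕ.⊔ N₂) ℕ.≤ i → M₂ ℕ.⊔ N₂ ℕ.≤ i
        r = ℕ.m⊔n≤o⇒n≤o (M₁ ℕ.⊔ N₁) (M₂ ℕ.⊔ N₂)

open Convergence

infixl 6 _+_
infixl 7 _*_ _/_!
infix  8 -_
infixr 9 _^_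

fromℚ : ℚ → ℝ
fromℚ q = lim (λ _ → q) (const-cauchy q)

_+_ _*_ : ℝ → ℝ → ℝ
lim x X + lim y Y = lim (λ n → x n ℚ.+ y n) (+-cauchy x y X Y)
lim x X * lim y Y = lim (λ n → x n ℚ.* y n) (*-cauchy x y X Y)

-_ : ℝ → ℝ
- lim x X = lim (λ n → ℚ.- x n) (neg-cauchy x X)

0ℝ 1ℝ : ℝ
0ℝ = fromℚ 0ℚ
1ℝ = fromℚ 1ℚ

_^_ : ℝ → ℕ → ℝ
x ^ zero  = 1ℝ
x ^ suc n = x * x ^ n

_/_! : ℝ → ℕ → ℝ
x / n ! = x * fromℚ ((ℤ.+ 1 ℚ./ n !) {{n !≢0}})

∑₁ : ℕ → (ℕ → ℝ) → ℝ
∑₁ zero    f = 0ℝ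
∑₁ (suc n) f = ∑₁ n f + f (suc n)

infix 5 ∑₁
syntax ∑₁ n (λ i → x) = ∑[1≤ i ≤ n ] x

ζ : (es : List Entry) .{{_ : Admissible es}} → ℝ
ζ es {{a}} = lim (partial es) (partial-cauchy es a)

-- ln 2 = ∫₁² dt/t
ln2 : ℝ
ln2 = lim riemann-1/t riemann-cauchy

ones : ℕ → List Entry
ones r = replicate r (plain 1)

{-# OPTIONS --safe #-}

-- Barring the leading entry evaluates a multiple polylogarithm at -1, and
-- the identity is a shuffle relation between the power series
-- Pᵢ = Li({1}ᵢ), Qⱼ = Li({1}ⱼ, 3, {1}ₖ₋₁) and Cₖ = Li(2, {1}ₖ₋₁).  The Euler
-- derivation θ = t d/dt sends Pᵢ₊₁ and Qⱼ₊₁ to t/(1-t) times Pᵢ and Qⱼ,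
-- so the derivative of T(m,k) = Σᵢ (-1)ⁱ Pᵢ Qₘ₋ᵢ telescopes to (-1)ᵐ Pₘ Cₖ,
-- and hence (-1)ᵐ T(m,k) + (-1)ᵏ T(k,m) = Cₘ Cₖ because θ Cₘ = Pₘ.
-- At t = -1 the series converge only conditionally, but the Cesàro means
-- of a Cauchy product always tend to the product of the two limits, so the
-- identity can be evaluated without showing that the products converge.
-- In the same way Pᵢ tends to (-ln 2)ⁱ / i!, from P₁ Pᵢ = (i+1) Pᵢ₊₁.

module Submission where

open import Algebra.Definitions.RawSemiring as RawSemiring using ()
import Data.Integer.Base as ℤ
open import Data.List.Base using (List; []; _∷_; _++_)
open import Data.Nat.Base as ℕ using (ℕ; zero; suc; _∸_; NonZero; _!)
import Data.Nat.Properties as ℕ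
open import Data.Nat.Properties using (_!≢0)
open import Data.Product.Base using (∃; _×_; _,_; proj₁; proj₂)
import Data.Rational.Base as ℚ
import Data.Rational.Properties as ℚ
import Data.Rational.Unnormalised.Base as ℚᵘ
import Data.Rational.Unnormalised.Properties as ℚᵘ
open import Data.Sum.Base using (inj₁; inj₂)
open import Data.Unit.Base using (tt)
open import Relation.Binary.PropositionalEquality
open import Relation.Nullary using (contradiction-irr)
import Defs

-- Formal power series: Cauchy products, the Euler derivation and polylogarithm coefficients.

module PowerSeries where
  open Defs using (Entry; plain; bar; factor; partial; ones; ∑<; module Convergence)
  open Convergence using (nat; nat-suc; recip; recip-nat)
  open import Data.Rational.Base using (ℚ; 0ℚ; 1ℚ; _+_; _*_; -_)
  open import Data.Rational.Solver using (module +-*-Solver)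
  open +-*-Solver using (solve; con; _:=_; _:+_; _:*_; _:-_; :-_)
  open RawSemiring ℚ.+-*-rawSemiring using () renaming (_^_ to infixr 9 _^_)
  open ≡-Reasoning

  infixl 7 _⊛_
  infixl 6 _∔_
  infixr 8 _·_

  -- The Cauchy product recurses by shifting the right factor, which avoids the truncated
  -- subtraction in `g (n ∸ i)`.
  _⊛_ _∔_ : (ℕ → ℚ) → (ℕ → ℚ) → ℕ → ℚ
  (f ⊛ g) zero    = f 0 * g 0
  (f ⊛ g) (suc n) = (f ⊛ λ i → g (suc i)) n + f (suc n) * g 0
  (f ∔ g) n = f n + g n

  _·_ : ℚ → (ℕ → ℚ) → ℕ → ℚ
  (c · f) n = c * f n

  -- On generating series, `Σ₀` multiplies by t/(1-t) and `Σ₁` by 1/(1-t), `θ` is t d/dt, and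
  -- `signed` substitutes -t for t.
  Σ₀ Σ₁ θ signed : (ℕ → ℚ) → ℕ → ℚ
  Σ₀ f n = ∑< n f
  Σ₁ f n = ∑< (suc n) f
  θ f n = nat n * f n
  signed f n = (- 1ℚ) ^ n * f n

  Σ₀-cong : ∀ {f g} → f ≗ g → Σ₀ f ≗ Σ₀ g
  Σ₀-cong p zero    = refl
  Σ₀-cong p (suc n) = cong₂ _+_ (Σ₀-cong p n) (p n)

  Σ₁-cong : ∀ {f g} → f ≗ g → Σ₁ f ≗ Σ₁ g
  Σ₁-cong p n = Σ₀-cong p (suc n)

  Σ₀-∔ : ∀ f g → Σ₀ (f ∔ g) ≗ Σ₀ f ∔ Σ₀ g
  Σ₀-∔ f g zero    = refl
  Σ₀-∔ f g (suc n) = trans (cong (_+ (f n + g n)) (Σ₀-∔ f g n))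
    (solve 4 (λ a b c d → (a :+ b) :+ (c :+ d) := (a :+ c) :+ (b :+ d)) refl (Σ₀ f n) (Σ₀ g n) (f n) (g n))

  Σ₀-· : ∀ c f → Σ₀ (c · f) ≗ c · Σ₀ f
  Σ₀-· c f zero    = sym (ℚ.*-zeroʳ c)
  Σ₀-· c f (suc n) = trans (cong (_+ c * f n) (Σ₀-· c f n)) (sym (ℚ.*-distribˡ-+ c (Σ₀ f n) (f n)))

  ⊛-cong : ∀ {f f′ g g′} → f ≗ f′ → g ≗ g′ → f ⊛ g ≗ f′ ⊛ g′
  ⊛-cong p q zero    = cong₂ _*_ (p 0) (q 0)
  ⊛-cong p q (suc n) = cong₂ _+_ (⊛-cong p (λ i → q (suc i)) n) (cong₂ _*_ (p (suc n)) (q 0))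

  ⊛-unfoldˡ : ∀ f g n → (f ⊛ g) (suc n) ≡ f 0 * g (suc n) + ((λ i → f (suc i)) ⊛ g) n
  ⊛-unfoldˡ f g zero    = refl
  ⊛-unfoldˡ f g (suc n) = trans (cong (_+ f (suc (suc n)) * g 0) (⊛-unfoldˡ f (λ i → g (suc i)) n))
    (ℚ.+-assoc (f 0 * g (suc (suc n))) _ (f (suc (suc n)) * g 0))

  ⊛-comm : ∀ f g → f ⊛ g ≗ g ⊛ f
  ⊛-comm f g zero    = ℚ.*-comm (f 0) (g 0)
  ⊛-comm f g (suc n) = begin
    (f ⊛ g′) n + f (suc n) * g 0 ≡⟨ cong₂ _+_ (⊛-comm f g′ n) (ℚ.*-comm (f (suc n)) (g 0)) ⟩
    (g′ ⊛ f) n + g 0 * f (suc n) ≡⟨ ℚ.+-comm ((g′ ⊛ f) n) (g 0 * f (suc n)) ⟩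
    g 0 * f (suc n) + (g′ ⊛ f) n ≡⟨ ⊛-unfoldˡ g f n ⟨
    (g ⊛ f) (suc n)              ∎
    where
    g′ : ℕ → ℚ
    g′ i = g (suc i)

  ⊛-distribˡ : ∀ f g h → f ⊛ (g ∔ h) ≗ f ⊛ g ∔ f ⊛ h
  ⊛-distribˡ f g h zero    = ℚ.*-distribˡ-+ (f 0) (g 0) (h 0)
  ⊛-distribˡ f g h (suc n) = trans (cong (_+ f (suc n) * (g 0 + h 0)) (⊛-distribˡ f (λ i → g (suc i)) (λ i → h (suc i)) n))
    (solve 5 (λ a b f g h → (a :+ b) :+ f :* (g :+ h) := (a :+ f :* g) :+ (b :+ f :* h)) refl
      ((f ⊛ λ i → g (suc i)) n) ((f ⊛ λ i → h (suc i)) n) (f (suc n)) (g 0) (h 0))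

  ⊛-·ʳ : ∀ c f g → f ⊛ c · g ≗ c · (f ⊛ g)
  ⊛-·ʳ c f g zero    = solve 3 (λ c f g → f :* (c :* g) := c :* (f :* g)) refl c (f 0) (g 0)
  ⊛-·ʳ c f g (suc n) = trans (cong (_+ f (suc n) * (c * g 0)) (⊛-·ʳ c f (λ i → g (suc i)) n))
    (solve 4 (λ c a f g → c :* a :+ f :* (c :* g) := c :* (a :+ f :* g)) refl c ((f ⊛ λ i → g (suc i)) n) (f (suc n)) (g 0))

  ⊛-·ˡ : ∀ c f g → c · f ⊛ g ≗ c · (f ⊛ g)
  ⊛-·ˡ c f g n = trans (⊛-comm (c · f) g n) (trans (⊛-·ʳ c g f n) (cong (c *_) (⊛-comm g f n)))

  ⊛-Σ₀ʳ : ∀ f g → f ⊛ Σ₀ g ≗ Σ₀ (f ⊛ g)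
  ⊛-Σ₀ʳ f g zero    = ℚ.*-zeroʳ (f 0)
  ⊛-Σ₀ʳ f g (suc n) = begin
    -- Shifting `Σ₀ g` by one gives `Σ₀ g ∔ g` definitionally, and its constant term is 0.
    (f ⊛ (Σ₀ g ∔ g)) n + f (suc n) * 0ℚ ≡⟨ cong ((f ⊛ (Σ₀ g ∔ g)) n +_) (ℚ.*-zeroʳ (f (suc n))) ⟩
    (f ⊛ (Σ₀ g ∔ g)) n + 0ℚ             ≡⟨ ℚ.+-identityʳ _ ⟩
    (f ⊛ (Σ₀ g ∔ g)) n                  ≡⟨ ⊛-distribˡ f (Σ₀ g) g n ⟩
    (f ⊛ Σ₀ g) n + (f ⊛ g) n            ≡⟨ cong (_+ (f ⊛ g) n) (⊛-Σ₀ʳ f g n) ⟩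
    Σ₀ (f ⊛ g) (suc n)                  ∎

  ⊛-Σ₀ˡ : ∀ f g → Σ₀ f ⊛ g ≗ Σ₀ (f ⊛ g)
  ⊛-Σ₀ˡ f g n = trans (⊛-comm (Σ₀ f) g n) (trans (⊛-Σ₀ʳ g f n) (Σ₀-cong (⊛-comm g f) n))

  ⊛-Σ₁ʳ : ∀ f g → f ⊛ Σ₁ g ≗ Σ₁ (f ⊛ g)
  ⊛-Σ₁ʳ f g n = trans (⊛-distribˡ f (Σ₀ g) g n) (cong (_+ (f ⊛ g) n) (⊛-Σ₀ʳ f g n))

  ⊛-Σ₁ˡ : ∀ f g → Σ₁ f ⊛ g ≗ Σ₁ (f ⊛ g)
  ⊛-Σ₁ˡ f g n = trans (⊛-comm (Σ₁ f) g n) (trans (⊛-Σ₁ʳ g f n) (Σ₁-cong (⊛-comm g f) n))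

  -- Substituting -t for t is a ring homomorphism: the sign at n splits over i and n - i.
  signed-⊛ : ∀ f g → signed f ⊛ signed g ≗ signed (f ⊛ g)
  signed-⊛ f g zero    = solve 2 (λ f g → (con 1ℚ :* f) :* (con 1ℚ :* g) := con 1ℚ :* (f :* g)) refl (f 0) (g 0)
  signed-⊛ f g (suc n) = begin
    (signed f ⊛ λ i → signed g (suc i)) n + signed f (suc n) * (1ℚ * g 0)
      ≡⟨ cong (_+ signed f (suc n) * (1ℚ * g 0)) (⊛-cong {signed f} (λ _ → refl) (λ i → ℚ.*-assoc (- 1ℚ) ((- 1ℚ) ^ i) (g′ i)) n) ⟩
    (signed f ⊛ (- 1ℚ) · signed g′) n + signed f (suc n) * (1ℚ * g 0)
      ≡⟨ cong (_+ signed f (suc n) * (1ℚ * g 0)) (trans (⊛-·ʳ (- 1ℚ) (signed f) (signed g′) n) (cong (- 1ℚ *_) (signed-⊛ f g′ n))) ⟩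
    - 1ℚ * (s * (f ⊛ g′) n) + - 1ℚ * s * f (suc n) * (1ℚ * g 0)
      ≡⟨ solve 4 (λ s a f g → con (- 1ℚ) :* (s :* a) :+ con (- 1ℚ) :* s :* f :* (con 1ℚ :* g) := con (- 1ℚ) :* s :* (a :+ f :* g))
           refl s ((f ⊛ g′) n) (f (suc n)) (g 0) ⟩
    signed (f ⊛ g) (suc n) ∎
    where
    s = (- 1ℚ) ^ n
    g′ : ℕ → ℚ
    g′ i = g (suc i)

  -- Leibniz rule, from n = i + (n - i).
  θ-⊛ : ∀ f g → θ (f ⊛ g) ≗ θ f ⊛ g ∔ f ⊛ θ g
  θ-⊛ f g zero    = solve 2 (λ f g → con 0ℚ :* (f :* g) := con 0ℚ :* f :* g :+ f :* (con 0ℚ :* g)) refl (f 0) (g 0)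
  θ-⊛ f g (suc n) = begin
    nat (suc n) * (a + f (suc n) * g 0)
      ≡⟨ cong (_* (a + f (suc n) * g 0)) (nat-suc n) ⟩
    (1ℚ + nat n) * (a + f (suc n) * g 0)
      ≡⟨ solve 4 (λ n a f g → (con 1ℚ :+ n) :* (a :+ f :* g) := n :* a :+ a :+ (con 1ℚ :+ n) :* (f :* g)) refl (nat n) a (f (suc n)) (g 0) ⟩
    nat n * a + a + (1ℚ + nat n) * (f (suc n) * g 0)
      ≡⟨ cong₂ (λ u v → u + a + v * (f (suc n) * g 0)) (θ-⊛ f g′ n) (sym (nat-suc n)) ⟩
    b + c + a + nat (suc n) * (f (suc n) * g 0)
      ≡⟨ solve 6 (λ a b c N f g → b :+ c :+ a :+ N :* (f :* g) := (b :+ (N :* f) :* g) :+ ((a :+ c) :+ f :* (con 0ℚ :* g)))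
           refl a b c (nat (suc n)) (f (suc n)) (g 0) ⟩
    (b + θ f (suc n) * g 0) + ((a + c) + f (suc n) * (0ℚ * g 0))
      ≡⟨ cong (λ u → (b + θ f (suc n) * g 0) + (u + f (suc n) * (0ℚ * g 0)))
           (trans (sym (⊛-distribˡ f g′ (θ g′) n)) (⊛-cong {f} (λ _ → refl) θ-shift n)) ⟩
    (b + θ f (suc n) * g 0) + ((f ⊛ λ i → θ g (suc i)) n + f (suc n) * (0ℚ * g 0)) ∎
    where
    g′ : ℕ → ℚ
    g′ i = g (suc i)
    a = (f ⊛ g′) n
    b = (θ f ⊛ g′) n
    c = (f ⊛ θ g′) n
    -- `θ` does not commute with the shift: the index grows by one, which adds a copy of the shifted
    -- series.
    θ-shift : g′ ∔ θ g′ ≗ λ i → θ g (suc i)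
    θ-shift i = trans (solve 2 (λ n x → x :+ n :* x := (con 1ℚ :+ n) :* x) refl (nat i) (g′ i)) (cong (_* g′ i) (sym (nat-suc i)))

  recip-nat-cancel : ∀ n x → recip n * (nat (suc n) * x) ≡ x
  recip-nat-cancel n x = trans (sym (ℚ.*-assoc (recip n) (nat (suc n)) x))
    (trans (cong (_* x) (recip-nat n)) (ℚ.*-identityˡ x))

  nat-recip-cancel : ∀ n x → nat (suc n) * (recip n * x) ≡ x
  nat-recip-cancel n x = trans (solve 3 (λ N r x → N :* (r :* x) := r :* (N :* x)) refl (nat (suc n)) (recip n) x) (recip-nat-cancel n x)

  -- `θ` kills only constants, so this stands in for integration.
  θ-injective : ∀ {f g} → f 0 ≡ g 0 → θ f ≗ θ g → f ≗ g
  θ-injective p q zero    = p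
  θ-injective {f} {g} p q (suc n) = trans (sym (recip-nat-cancel n (f (suc n))))
    (trans (cong (recip n *_) (q (suc n))) (recip-nat-cancel n (g (suc n))))

  θ-· : ∀ c f → θ (c · f) ≗ c · θ f
  θ-· c f n = solve 3 (λ n c f → n :* (c :* f) := c :* (n :* f)) refl (nat n) c (f n)

  -- The coefficients of the multiple polylogarithm of an unbarred string,
  -- so that evaluation at -1 bars the leading entry.
  Li : List Entry → ℕ → ℚ
  Li []       zero    = 1ℚ
  Li []       (suc _) = 0ℚ
  Li (e ∷ es) zero    = 0ℚ
  Li (e ∷ es) (suc j) = factor e (suc j) * partial es j

  Σ₁-Li : ∀ es → Σ₁ (Li es) ≗ partial es
  Σ₁-Li []       zero    = refl
  Σ₁-Li []       (suc n) = trans (ℚ.+-identityʳ (Σ₁ (Li []) n)) (Σ₁-Li [] n)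
  Σ₁-Li (e ∷ es) zero    = refl
  Σ₁-Li (e ∷ es) (suc n) = cong (_+ Li (e ∷ es) (suc n)) (Σ₁-Li (e ∷ es) n)

  Σ₁-signed-Li : ∀ s .{{_ : NonZero s}} es → Σ₁ (signed (Li (plain s ∷ es))) ≗ partial (bar s ∷ es)
  Σ₁-signed-Li s es zero    = refl
  Σ₁-signed-Li s es (suc n) = cong₂ _+_ (Σ₁-signed-Li s es n) (sym (ℚ.*-assoc ((- 1ℚ) ^ suc n) (recip n ^ s) (partial es n)))

  -- The factor n cancels the 1/n of the leading entry; what remains is the inner sum, a running sum
  -- of the coefficients of the shorter series.
  θ-Li-1 : ∀ es → θ (Li (plain 1 ∷ es)) ≗ Σ₀ (Li es)
  θ-Li-1 es zero    = refl
  θ-Li-1 es (suc n) = begin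
    nat (suc n) * (recip n * 1ℚ * partial es n) ≡⟨ cong (λ r → nat (suc n) * (r * partial es n)) (ℚ.*-identityʳ (recip n)) ⟩
    nat (suc n) * (recip n * partial es n)      ≡⟨ nat-recip-cancel n (partial es n) ⟩
    partial es n                                ≡⟨ Σ₁-Li es n ⟨
    Σ₁ (Li es) n                                ∎

  θ-Li-suc : ∀ s es → θ (Li (plain (suc (suc s)) ∷ es)) ≗ Li (plain (suc s) ∷ es)
  θ-Li-suc s es zero    = refl
  θ-Li-suc s es (suc n) = trans (cong (nat (suc n) *_) (ℚ.*-assoc (recip n) (recip n ^ suc s) (partial es n)))
    (nat-recip-cancel n (recip n ^ suc s * partial es n))

  ⊛-identityʳ : ∀ f → f ⊛ Li [] ≗ f
  ⊛-identityʳ f zero    = ℚ.*-identityʳ (f 0)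
  ⊛-identityʳ f (suc n) = begin
    (f ⊛ λ i → Li [] (suc i)) n + f (suc n) * 1ℚ ≡⟨ cong₂ _+_ (zeros n) (ℚ.*-identityʳ (f (suc n))) ⟩
    0ℚ + f (suc n)                               ≡⟨ ℚ.+-identityˡ (f (suc n)) ⟩
    f (suc n)                                    ∎
    where
    zeros : ∀ n → (f ⊛ λ _ → 0ℚ) n ≡ 0ℚ
    zeros zero    = ℚ.*-zeroʳ (f 0)
    zeros (suc n) = trans (cong₂ _+_ (zeros n) (ℚ.*-zeroʳ (f (suc n)))) (ℚ.+-identityʳ 0ℚ)

  ⊛-identityˡ : ∀ f → Li [] ⊛ f ≗ f
  ⊛-identityˡ f n = trans (⊛-comm (Li []) f n) (⊛-identityʳ f n)

  -- Here `Li (ones 1)` is -ln(1-t) and `Li (ones i)` is its i-th power over i!. When the second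
  -- factor is `Li (ones (suc i))`, `θ` yields one copy of `Σ₀ (Li (ones (suc i)))` from the first
  -- factor and, by induction, i + 1 copies from the second.
  ones-⊛ : ∀ i → Li (ones 1) ⊛ Li (ones i) ≗ nat (suc i) · Li (ones (suc i))
  ones-⊛ zero    n = trans (⊛-identityʳ (Li (ones 1)) n) (sym (ℚ.*-identityˡ (Li (ones 1) n)))
  ones-⊛ (suc i) = θ-injective (sym (ℚ.*-zeroʳ (nat (suc (suc i))))) λ n → begin
    θ (P 1 ⊛ P (suc i)) n
      ≡⟨ θ-⊛ (P 1) (P (suc i)) n ⟩
    (θ (P 1) ⊛ P (suc i)) n + (P 1 ⊛ θ (P (suc i))) n
      ≡⟨ cong₂ _+_ (⊛-cong {g = P (suc i)} (θ-Li-1 []) (λ _ → refl) n) (⊛-cong {P 1} (λ _ → refl) (θ-Li-1 (ones i)) n) ⟩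
    (Σ₀ (P 0) ⊛ P (suc i)) n + (P 1 ⊛ Σ₀ (P i)) n
      ≡⟨ cong₂ _+_ (⊛-Σ₀ˡ (P 0) (P (suc i)) n) (⊛-Σ₀ʳ (P 1) (P i) n) ⟩
    Σ₀ (P 0 ⊛ P (suc i)) n + Σ₀ (P 1 ⊛ P i) n
      ≡⟨ cong₂ _+_ (Σ₀-cong (⊛-identityˡ (P (suc i))) n) (trans (Σ₀-cong (ones-⊛ i) n) (Σ₀-· (nat (suc i)) (P (suc i)) n)) ⟩
    S n + nat (suc i) * S n
      ≡⟨ solve 2 (λ k s → s :+ k :* s := (con 1ℚ :+ k) :* s) refl (nat (suc i)) (S n) ⟩
    (1ℚ + nat (suc i)) * S n
      ≡⟨ cong₂ _*_ (nat-suc (suc i)) (θ-Li-1 (ones (suc i)) n) ⟨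
    nat (suc (suc i)) * θ (P (suc (suc i))) n
      ≡⟨ θ-· (nat (suc (suc i))) (P (suc (suc i))) n ⟨
    θ (nat (suc (suc i)) · P (suc (suc i))) n ∎
    where
    P : ℕ → ℕ → ℚ
    P j = Li (ones j)
    S = Σ₀ (P (suc i))

  -- Evaluated at -1, P± i is (ln 2)ⁱ / i! and Q k j is the value of the
  -- string (1̄, {1}ⱼ₋₁, 3, {1}ₖ): this k is the k - 1 of the theorem.
  P± : ℕ → ℕ → ℚ
  P± i = (- 1ℚ) ^ i · Li (ones i)

  Q : ℕ → ℕ → ℕ → ℚ
  Q k j = Li (ones j ++ plain 3 ∷ ones k)

  θ-P±-suc : ∀ i → θ (P± (suc i)) ≗ (- 1ℚ) · Σ₀ (P± i)
  θ-P±-suc i n = begin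
    θ (P± (suc i)) n                             ≡⟨ θ-· ((- 1ℚ) ^ suc i) (Li (ones (suc i))) n ⟩
    - 1ℚ * (- 1ℚ) ^ i * θ (Li (ones (suc i))) n  ≡⟨ cong (- 1ℚ * (- 1ℚ) ^ i *_) (θ-Li-1 (ones i) n) ⟩
    - 1ℚ * (- 1ℚ) ^ i * Σ₀ (Li (ones i)) n       ≡⟨ ℚ.*-assoc (- 1ℚ) ((- 1ℚ) ^ i) (Σ₀ (Li (ones i)) n) ⟩
    - 1ℚ * ((- 1ℚ) ^ i * Σ₀ (Li (ones i)) n)     ≡⟨ cong (- 1ℚ *_) (Σ₀-· ((- 1ℚ) ^ i) (Li (ones i)) n) ⟨
    - 1ℚ * Σ₀ (P± i) n                           ∎

  -- antipode m k i = Σ_{j ≤ i} P± j ⊛ Q k (m - j).  Under θ the sum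
  -- telescopes, as in the antipode relation of the shuffle Hopf algebra.
  antipode : ℕ → ℕ → ℕ → ℕ → ℚ
  antipode m k zero    = P± 0 ⊛ Q k m
  antipode m k (suc i) = antipode m k i ∔ P± (suc i) ⊛ Q k (m ∸ suc i)

  -- The Leibniz rule with the derivative of `P±` made explicit; its sign -1 is what cancels the
  -- surviving term of the previous summand in `antipode`.
  θ-P±-⊛ : ∀ i g → θ (P± (suc i) ⊛ g) ≗ (- 1ℚ) · Σ₀ (P± i ⊛ g) ∔ P± (suc i) ⊛ θ g
  θ-P±-⊛ i g n = begin
    θ (P± (suc i) ⊛ g) n
      ≡⟨ θ-⊛ (P± (suc i)) g n ⟩
    (θ (P± (suc i)) ⊛ g) n + (P± (suc i) ⊛ θ g) n
      ≡⟨ cong (_+ (P± (suc i) ⊛ θ g) n) (⊛-cong {g = g} (θ-P±-suc i) (λ _ → refl) n) ⟩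
    ((- 1ℚ) · Σ₀ (P± i) ⊛ g) n + (P± (suc i) ⊛ θ g) n
      ≡⟨ cong (_+ (P± (suc i) ⊛ θ g) n) (trans (⊛-·ˡ (- 1ℚ) (Σ₀ (P± i)) g n) (cong (- 1ℚ *_) (⊛-Σ₀ˡ (P± i) g n))) ⟩
    - 1ℚ * Σ₀ (P± i ⊛ g) n + (P± (suc i) ⊛ θ g) n ∎

  -- The Leibniz term differentiating `Q` in one summand cancels the term differentiating `P±` in
  -- the next, so only the last `Q` term survives. The bound on i keeps a leading 1 in every `Q` met
  -- so far.
  θ-antipode-partial : ∀ m k i → i ℕ.≤ m → θ (antipode (suc m) k i) ≗ Σ₀ (P± i ⊛ Q k (m ∸ i))
  θ-antipode-partial m k zero _ n = begin
    θ (P± 0 ⊛ Q k (suc m)) n ≡⟨ cong (nat n *_) (P±0 (Q k (suc m)) n) ⟩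
    θ (Q k (suc m)) n        ≡⟨ θ-Li-1 (ones m ++ plain 3 ∷ ones k) n ⟩
    Σ₀ (Q k m) n             ≡⟨ Σ₀-cong (P±0 (Q k m)) n ⟨
    Σ₀ (P± 0 ⊛ Q k m) n      ∎
    where
    P±0 : ∀ f → P± 0 ⊛ f ≗ f
    P±0 f n = trans (⊛-·ˡ 1ℚ (Li []) f n) (trans (ℚ.*-identityˡ _) (⊛-identityˡ f n))
  θ-antipode-partial m k (suc i) i<m n = begin
    nat n * (antipode (suc m) k i n + (P± (suc i) ⊛ Q k (m ∸ i)) n)
      ≡⟨ ℚ.*-distribˡ-+ (nat n) (antipode (suc m) k i n) _ ⟩
    θ (antipode (suc m) k i) n + θ (P± (suc i) ⊛ Q k (m ∸ i)) n
      ≡⟨ cong₂ _+_ (θ-antipode-partial m k i (ℕ.<⇒≤ i<m) n) (θ-P±-⊛ i (Q k (m ∸ i)) n) ⟩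
    A + (- 1ℚ * A + (P± (suc i) ⊛ θ (Q k (m ∸ i))) n)
      ≡⟨ cong (λ u → A + (- 1ℚ * A + u)) (trans (⊛-cong {P± (suc i)} (λ _ → refl) θ-Q n) (⊛-Σ₀ʳ (P± (suc i)) (Q k (m ∸ suc i)) n)) ⟩
    A + (- 1ℚ * A + B)
      ≡⟨ solve 2 (λ a b → a :+ (con (- 1ℚ) :* a :+ b) := b) refl A B ⟩
    B ∎
    where
    A = Σ₀ (P± i ⊛ Q k (m ∸ i)) n
    B = Σ₀ (P± (suc i) ⊛ Q k (m ∸ suc i)) n
    θ-Q : θ (Q k (m ∸ i)) ≗ Σ₀ (Q k (m ∸ suc i))
    θ-Q j = trans (cong (λ l → θ (Q k l) j) (ℕ.+-∸-assoc 1 i<m)) (θ-Li-1 (ones (m ∸ suc i) ++ plain 3 ∷ ones k) j)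

  -- The last summand carries `Q k 0`, whose leading entry 3 drops to 2 under `θ` without a factor
  -- t/(1-t). This ends the telescoping.
  θ-antipode : ∀ m k → θ (antipode (suc m) k (suc m)) ≗ P± (suc m) ⊛ Li (plain 2 ∷ ones k)
  θ-antipode m k n = begin
    nat n * (antipode (suc m) k m n + (P± (suc m) ⊛ Q k (m ∸ m)) n)
      ≡⟨ ℚ.*-distribˡ-+ (nat n) (antipode (suc m) k m n) _ ⟩
    θ (antipode (suc m) k m) n + θ (P± (suc m) ⊛ Q k (m ∸ m)) n
      ≡⟨ cong₂ _+_ (θ-antipode-partial m k m ℕ.≤-refl n) (θ-P±-⊛ m (Q k (m ∸ m)) n) ⟩
    A + (- 1ℚ * A + (P± (suc m) ⊛ θ (Q k (m ∸ m))) n)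
      ≡⟨ solve 2 (λ a b → a :+ (con (- 1ℚ) :* a :+ b) := b) refl A ((P± (suc m) ⊛ θ (Q k (m ∸ m))) n) ⟩
    (P± (suc m) ⊛ θ (Q k (m ∸ m))) n
      ≡⟨ ⊛-cong {P± (suc m)} (λ _ → refl) (λ j → trans (cong (λ l → θ (Q k l) j) (ℕ.n∸n≡0 m)) (θ-Li-suc 1 (ones k) j)) n ⟩
    (P± (suc m) ⊛ Li (plain 2 ∷ ones k)) n ∎
    where A = Σ₀ (P± m ⊛ Q k (m ∸ m)) n

  sign² : ∀ n x → (- 1ℚ) ^ n * ((- 1ℚ) ^ n * x) ≡ x
  sign² zero    x = trans (ℚ.*-identityˡ (1ℚ * x)) (ℚ.*-identityˡ x)
  sign² (suc n) x = trans (solve 2 (λ s x → con (- 1ℚ) :* s :* (con (- 1ℚ) :* s :* x) := s :* (s :* x)) refl ((- 1ℚ) ^ n) x) (sign² n x)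

  -- Both sides have constant term 0 and the same image under `θ`: once the signs in `P±` are
  -- squared away, the two antipodes give the two Leibniz terms of the product, because `θ` lowers a
  -- leading 2 to a 1.
  antipode-symmetrised : ∀ m k → (- 1ℚ) ^ suc m · antipode (suc m) k (suc m) ∔ (- 1ℚ) ^ suc k · antipode (suc k) m (suc k)
    ≗ Li (plain 2 ∷ ones m) ⊛ Li (plain 2 ∷ ones k)
  antipode-symmetrised m k = θ-injective const≡0 λ n → begin
    nat n * ((- 1ℚ) ^ suc m * a n + (- 1ℚ) ^ suc k * b n)
      ≡⟨ solve 5 (λ N s t a b → N :* (s :* a :+ t :* b) := s :* (N :* a) :+ t :* (N :* b)) refl (nat n) ((- 1ℚ) ^ suc m) ((- 1ℚ) ^ suc k) (a n) (b n) ⟩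
    (- 1ℚ) ^ suc m * θ a n + (- 1ℚ) ^ suc k * θ b n
      ≡⟨ cong₂ _+_ (half m k n) (half k m n) ⟩
    (Li (ones (suc m)) ⊛ D k) n + (Li (ones (suc k)) ⊛ D m) n
      ≡⟨ cong₂ _+_ (⊛-cong {g = D k} (θ-Li-suc 0 (ones m)) (λ _ → refl) n)
           (trans (⊛-comm (D m) (θ (D k)) n) (⊛-cong {g = D m} (θ-Li-suc 0 (ones k)) (λ _ → refl) n)) ⟨
    (θ (D m) ⊛ D k) n + (D m ⊛ θ (D k)) n
      ≡⟨ θ-⊛ (D m) (D k) n ⟨
    θ (D m ⊛ D k) n ∎
    where
    a = antipode (suc m) k (suc m)
    b = antipode (suc k) m (suc k)
    D : ℕ → ℕ → ℚ
    D j = Li (plain 2 ∷ ones j)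
    half : ∀ m k n → (- 1ℚ) ^ suc m * θ (antipode (suc m) k (suc m)) n ≡ (Li (ones (suc m)) ⊛ D k) n
    half m k n = trans (cong ((- 1ℚ) ^ suc m *_) (trans (θ-antipode m k n) (⊛-·ˡ ((- 1ℚ) ^ suc m) (Li (ones (suc m))) (D k) n)))
      (sign² (suc m) _)
    antipode-0 : ∀ m k i → antipode (suc m) k i 0 ≡ 0ℚ
    antipode-0 m k zero    = refl
    antipode-0 m k (suc i) = trans (cong₂ _+_ (antipode-0 m k i)
      (trans (cong (_* Q k (m ∸ i) 0) (ℚ.*-zeroʳ ((- 1ℚ) ^ suc i))) (ℚ.*-zeroˡ (Q k (m ∸ i) 0)))) (ℚ.+-identityʳ 0ℚ)
    const≡0 : (- 1ℚ) ^ suc m * a 0 + (- 1ℚ) ^ suc k * b 0 ≡ 0ℚ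
    const≡0 = trans (cong₂ (λ u v → (- 1ℚ) ^ suc m * u + (- 1ℚ) ^ suc k * v) (antipode-0 m k (suc m)) (antipode-0 k m (suc k)))
      (solve 2 (λ s t → s :* con 0ℚ :+ t :* con 0ℚ := con 0ℚ) refl ((- 1ℚ) ^ suc m) ((- 1ℚ) ^ suc k))

-- Vanishing sequences, mean deviations and Cesàro means of Cauchy products.

module Limits where
  open Defs using (Cauchy; module Convergence)
  open Convergence
  open PowerSeries using (_⊛_; _∔_; Σ₀; Σ₁; ⊛-comm; ⊛-cong)
  open import Data.Rational.Base using (ℚ; 0ℚ; 1ℚ; ½; _+_; _*_; _-_; -_; _≤_; _<_; ∣_∣)
  open import Data.Rational.Solver using (module +-*-Solver)
  open +-*-Solver using (solve; con; _:=_; _:+_; _:*_; _:-_; :-_)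
  open ℚ.≤-Reasoning

  -- `_≈_` unfolds to `Vanishing` of a termwise difference, so results in this form prove equalities
  -- of reals.
  Vanishing Bounded : (ℕ → ℚ) → Set
  Vanishing f = ∀ ε → 0ℚ < ε → ∃ λ N → ∀ n → N ℕ.≤ n → ∣ f n ∣ < ε
  Bounded f = ∃ λ B → 0ℚ < B × (∀ n → ∣ f n ∣ ≤ B)

  Vanishing-≤ : ∀ {f g} → (∀ n → ∣ g n ∣ ≤ ∣ f n ∣) → Vanishing f → Vanishing g
  Vanishing-≤ g≤f F ε 0<ε = proj₁ (F ε 0<ε) , λ n N≤n → ℚ.≤-<-trans (g≤f n) (proj₂ (F ε 0<ε) n N≤n)

  Vanishing-cong : ∀ {f g} → f ≗ g → Vanishing f → Vanishing g
  Vanishing-cong p = Vanishing-≤ λ n → ℚ.≤-reflexive (cong ∣_∣ (sym (p n)))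

  Vanishing-+ : ∀ {f g} → Vanishing f → Vanishing g → Vanishing (λ n → f n + g n)
  Vanishing-+ {f} {g} F G ε 0<ε = M ℕ.⊔ N , λ n ≤n → begin-strict
    ∣ f n + g n ∣         ≤⟨ ℚ.∣p+q∣≤∣p∣+∣q∣ (f n) (g n) ⟩
    ∣ f n ∣ + ∣ g n ∣     <⟨ ℚ.+-mono-< (proj₂ (F δ 0<δ) n (ℕ.m⊔n≤o⇒m≤o M N ≤n)) (proj₂ (G δ 0<δ) n (ℕ.m⊔n≤o⇒n≤o M N ≤n)) ⟩
    ½ * ε + ½ * ε         ≡⟨ solve 1 (λ e → con ½ :* e :+ con ½ :* e := e) refl ε ⟩
    ε                     ∎
    where
    δ = ½ * ε
    0<δ = 0<* ½-positive 0<ε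
    M = proj₁ (F δ 0<δ)
    N = proj₁ (G δ 0<δ)

  Vanishing-* : ∀ {f g} → Bounded f → Vanishing g → Vanishing (λ n → f n * g n)
  Vanishing-* {f} {g} (B , 0<B , f≤B) G ε 0<ε = proj₁ (G δ 0<δ) , λ n N≤n → begin-strict
    ∣ f n * g n ∣       ≤⟨ ∣*∣-mono (f n) (g n) (f≤B n) ℚ.≤-refl ⟩
    B * ∣ g n ∣         <⟨ ℚ.*-monoʳ-<-pos B (proj₂ (G δ 0<δ) n N≤n) ⟩
    B * (ℚ.1/ B * ε)    ≡⟨ ℚ.*-assoc B (ℚ.1/ B) ε ⟨
    B * ℚ.1/ B * ε      ≡⟨ cong (_* ε) (ℚ.*-inverseʳ B) ⟩
    1ℚ * ε              ≡⟨ ℚ.*-identityˡ ε ⟩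
    ε                   ∎
    where
    instance
      B>0 : ℚ.Positive B
      B>0 = ℚ.positive 0<B
      B≢0 : ℚ.NonZero B
      B≢0 = ℚ.pos⇒nonZero B
    δ = ℚ.1/ B * ε
    0<δ : 0ℚ < δ
    0<δ = 0<* (ℚ.positive⁻¹ (ℚ.1/ B) {{ℚ.1/pos⇒pos B}}) 0<ε

  p≤p+q : ∀ {p q} → 0ℚ ≤ q → p ≤ p + q
  p≤p+q {p} 0≤q = ℚ.≤-trans (ℚ.≤-reflexive (sym (ℚ.+-identityʳ p))) (ℚ.+-monoʳ-≤ p 0≤q)

  q≤p+q : ∀ {p q} → 0ℚ ≤ p → q ≤ p + q
  q≤p+q {p} {q} 0≤p = ℚ.≤-trans (p≤p+q 0≤p) (ℚ.≤-reflexive (ℚ.+-comm q p))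

  ∣recip∣≤ : ∀ n → ∣ recip n ∣ ≤ recip n
  ∣recip∣≤ n = ℚ.≤-reflexive (ℚ.0≤p⇒∣p∣≡p (0≤recip n))

  Bounded-const : ∀ c → Bounded (λ _ → c)
  Bounded-const c = ∣ c ∣ + 1ℚ , ℚ.+-mono-≤-< (ℚ.0≤∣p∣ c) (ℚ.positive⁻¹ 1ℚ) , λ _ → p≤p+q 0≤1

  0≤Σ₀∣∣ : ∀ (f : ℕ → ℚ) n → 0ℚ ≤ Σ₀ (λ i → ∣ f i ∣) n
  0≤Σ₀∣∣ f zero    = ℚ.≤-refl
  0≤Σ₀∣∣ f (suc n) = ℚ.+-mono-≤ (0≤Σ₀∣∣ f n) (ℚ.0≤∣p∣ (f n))

  ∣Σ₀∣≤ : ∀ (f : ℕ → ℚ) n → ∣ Σ₀ f n ∣ ≤ Σ₀ (λ i → ∣ f i ∣) n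
  ∣Σ₀∣≤ f zero    = ℚ.≤-refl
  ∣Σ₀∣≤ f (suc n) = ∣+∣-mono (Σ₀ f n) (f n) (∣Σ₀∣≤ f n) ℚ.≤-refl

  eventually-bounded⇒Bounded : ∀ {f} → EventuallyBounded f → Bounded f
  eventually-bounded⇒Bounded {f} (N , B , 0<B , f≤B) = S N + B , ℚ.+-mono-≤-< (0≤Σ₀∣∣ f N) 0<B , bound
    where
    S = Σ₀ (λ i → ∣ f i ∣)
    early : ∀ N n → n ℕ.< N → ∣ f n ∣ ≤ S N
    early (suc N) n (ℕ.s≤s n≤N) with ℕ.m≤n⇒m<n∨m≡n n≤N
    ... | inj₁ n<N  = ℚ.≤-trans (early N n n<N) (p≤p+q (ℚ.0≤∣p∣ (f N)))
    ... | inj₂ refl = q≤p+q (0≤Σ₀∣∣ f N)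
    bound : ∀ n → ∣ f n ∣ ≤ S N + B
    bound n with ℕ.<-≤-connex n N
    ... | inj₁ n<N = ℚ.≤-trans (early N n n<N) (p≤p+q (ℚ.<⇒≤ 0<B))
    ... | inj₂ N≤n = ℚ.≤-trans (f≤B n N≤n) (q≤p+q (0≤Σ₀∣∣ f N))

  Cauchy⇒Bounded : ∀ f → Cauchy f → Bounded f
  Cauchy⇒Bounded f F = eventually-bounded⇒Bounded {f} (eventually-bounded f F)

  recip-vanishing : Vanishing recip
  recip-vanishing ε 0<ε = N , λ n N≤n → begin-strict
    ∣ recip n ∣             ≡⟨ ℚ.0≤p⇒∣p∣≡p (0≤recip n) ⟩
    recip n                 ≡⟨ cong recip (ℕ.m+[n∸m]≡n N≤n) ⟨
    recip (N ℕ.+ (n ∸ N))   ≤⟨ recip-anti+ N (n ∸ N) ⟩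
    recip N                 <⟨ proj₂ (recip-null ε 0<ε) ⟩
    ε                       ∎
    where N = proj₁ (recip-null ε 0<ε)

  -- The mean is centred at the last term, since the limit of f need not be rational.
  deviation : (ℕ → ℚ) → ℕ → ℚ
  deviation f N = recip N * Σ₁ (λ i → ∣ f i - f N ∣) N

  -- Splits the sum at K: the early terms contribute an amount that does not grow with r, and all
  -- further cost is δ per term.
  Σ₀-≤ : ∀ {f g : ℕ → ℚ} {δ} K r → (∀ i → f i ≤ g i + δ) → (∀ i → K ℕ.≤ i → f i ≤ δ) →
    Σ₀ f (K ℕ.+ r) ≤ Σ₀ g K + nat (K ℕ.+ r) * δ
  Σ₀-≤ {f} {g} {δ} K zero f≤g f≤δ rewrite ℕ.+-identityʳ K = go K
    where
    go : ∀ K → Σ₀ f K ≤ Σ₀ g K + nat K * δ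
    go zero    = ℚ.≤-reflexive (solve 1 (λ d → con 0ℚ := con 0ℚ :+ con 0ℚ :* d) refl δ)
    go (suc K) = begin
      Σ₀ f K + f K                      ≤⟨ ℚ.+-mono-≤ (go K) (f≤g K) ⟩
      Σ₀ g K + nat K * δ + (g K + δ)    
        ≡⟨ solve 4 (λ a n d b → a :+ n :* d :+ (b :+ d) := (a :+ b) :+ (con 1ℚ :+ n) :* d) refl (Σ₀ g K) (nat K) δ (g K) ⟩
      Σ₀ g (suc K) + (1ℚ + nat K) * δ   ≡⟨ cong (λ n → Σ₀ g (suc K) + n * δ) (nat-suc K) ⟨
      Σ₀ g (suc K) + nat (suc K) * δ    ∎
  Σ₀-≤ {f} {g} {δ} K (suc r) f≤g f≤δ rewrite ℕ.+-suc K r = begin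
    Σ₀ f i + f i                ≤⟨ ℚ.+-mono-≤ (Σ₀-≤ K r f≤g f≤δ) (f≤δ i (ℕ.m≤m+n K r)) ⟩
    Σ₀ g K + nat i * δ + δ      ≡⟨ solve 3 (λ a n d → a :+ n :* d :+ d := a :+ (con 1ℚ :+ n) :* d) refl (Σ₀ g K) (nat i) δ ⟩
    Σ₀ g K + (1ℚ + nat i) * δ   ≡⟨ cong (λ n → Σ₀ g K + n * δ) (nat-suc i) ⟨
    Σ₀ g K + nat (suc i) * δ    ∎
    where i = K ℕ.+ r

  0≤deviation : ∀ f N → 0ℚ ≤ deviation f N
  0≤deviation f N = 0≤* (0≤recip N) (0≤Σ₀∣∣ (λ i → f i - f N) (suc N))

  -- Terms from K on differ from the last one by less than δ; beyond δ each, the earlier ones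
  -- contribute a fixed total, which division by N + 1 sends to 0.
  deviation-vanishing : ∀ f → Cauchy f → Vanishing (deviation f)
  deviation-vanishing f F ε 0<ε = K ℕ.⊔ M , λ N ≤N → begin-strict
    ∣ deviation f N ∣                           ≡⟨ ℚ.0≤p⇒∣p∣≡p (0≤deviation f N) ⟩
    recip N * Σ₁ (λ i → ∣ f i - f N ∣) N        ≤⟨ *-monoˡ (0≤recip N) (sum≤ N (ℕ.m⊔n≤o⇒m≤o K M ≤N)) ⟩
    recip N * (C + nat (suc N) * δ)             
      ≡⟨ solve 4 (λ r c n d → r :* (c :+ n :* d) := c :* r :+ (r :* n) :* d) refl (recip N) C (nat (suc N)) δ ⟩
    C * recip N + recip N * nat (suc N) * δ     ≡⟨ cong (λ u → C * recip N + u * δ) (recip-nat N) ⟩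
    C * recip N + 1ℚ * δ                        ≤⟨ ℚ.+-monoˡ-≤ (1ℚ * δ) (small N (ℕ.m⊔n≤o⇒n≤o K M ≤N)) ⟩
    δ + 1ℚ * δ                                  ≡⟨ cong (δ +_) (ℚ.*-identityˡ δ) ⟩
    δ + δ                                       <⟨ δ+δ<ε ⟩
    ε                                           ∎
    where
    -- A quarter of ε: both contributions are bounded by δ only weakly, and their total ε/2 leaves
    -- room for the strict inequality.
    δ = ½ * (½ * ε)
    0<δ : 0ℚ < δ
    0<δ = 0<* ½-positive (0<* ½-positive 0<ε)
    K = proj₁ (F δ 0<δ)
    C = Σ₀ (λ i → ∣ f i - f K ∣) K
    0≤C : 0ℚ ≤ C
    0≤C = 0≤Σ₀∣∣ (λ i → f i - f K) K
    CR = Vanishing-* (Bounded-const C) recip-vanishing δ 0<δ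
    M = proj₁ CR
    small : ∀ N → M ℕ.≤ N → C * recip N ≤ δ
    small N M≤N = ℚ.≤-trans (ℚ.≤-reflexive (sym (ℚ.0≤p⇒∣p∣≡p (0≤* 0≤C (0≤recip N))))) (ℚ.<⇒≤ (proj₂ CR N M≤N))
    δ+δ<ε : δ + δ < ε
    δ+δ<ε = begin-strict
      δ + δ             ≡⟨ ℚ.+-identityʳ (δ + δ) ⟨
      δ + δ + 0ℚ        <⟨ ℚ.+-monoʳ-< (δ + δ) (0<* ½-positive 0<ε) ⟩
      δ + δ + ½ * ε     ≡⟨ solve 1 (λ e → con ½ :* (con ½ :* e) :+ con ½ :* (con ½ :* e) :+ con ½ :* e := e) refl ε ⟩
      ε                 ∎
    sum≤ : ∀ N → K ℕ.≤ N → Σ₁ (λ i → ∣ f i - f N ∣) N ≤ C + nat (suc N) * δ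
    sum≤ N K≤N = subst (λ n → Σ₀ (λ i → ∣ f i - f N ∣) n ≤ C + nat n * δ) (ℕ.m+[n∸m]≡n (ℕ.m≤n⇒m≤1+n K≤N))
      (Σ₀-≤ {g = λ i → ∣ f i - f K ∣} K (suc N ∸ K)
        -- Passing through `f K` makes the bound on the early terms independent of N.
        (λ i → subst (λ u → ∣ u ∣ ≤ ∣ f i - f K ∣ + δ)
          (solve 3 (λ a b c → (a :- b) :+ (b :- c) := a :- c) refl (f i) (f K) (f N))
          (∣+∣-mono (f i - f K) (f K - f N) ℚ.≤-refl (ℚ.<⇒≤ (proj₂ (F δ 0<δ) K N ℕ.≤-refl K≤N))))
        (λ i K≤i → ℚ.<⇒≤ (proj₂ (F δ 0<δ) i N K≤i K≤N)))

  -- Recentring one factor of a product splits off a multiple of the running sum of the other.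
  ⊛-+const : ∀ f g c → f ⊛ (λ i → g i + c) ≗ λ n → (f ⊛ g) n + c * Σ₁ f n
  ⊛-+const f g c zero    = solve 3 (λ f g c → f :* (g :+ c) := f :* g :+ c :* (con 0ℚ :+ f)) refl (f 0) (g 0) c
  ⊛-+const f g c (suc n) = trans (cong (_+ f (suc n) * (g 0 + c)) (⊛-+const f (λ i → g (suc i)) c n))
    (solve 5 (λ a s f g c → a :+ c :* s :+ f :* (g :+ c) := a :+ f :* g :+ c :* (s :+ f)) refl
      ((f ⊛ λ i → g (suc i)) n) (Σ₁ f n) (f (suc n)) (g 0) c)

  ∣⊛∣≤ : ∀ f g {B} → (∀ i → ∣ g i ∣ ≤ B) → ∀ n → ∣ (f ⊛ g) n ∣ ≤ Σ₁ (λ i → ∣ f i ∣) n * B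
  ∣⊛∣≤ f g {B} g≤B zero    = subst (λ u → ∣ f 0 * g 0 ∣ ≤ u * B) (sym (ℚ.+-identityˡ ∣ f 0 ∣))
    (∣*∣-mono (f 0) (g 0) ℚ.≤-refl (g≤B 0))
  ∣⊛∣≤ f g {B} g≤B (suc n) = subst (∣ (f ⊛ g) (suc n) ∣ ≤_) (sym (ℚ.*-distribʳ-+ B (Σ₁ (λ i → ∣ f i ∣) n) ∣ f (suc n) ∣))
    (∣+∣-mono ((f ⊛ λ i → g (suc i)) n) (f (suc n) * g 0)
      (∣⊛∣≤ f (λ i → g (suc i)) (λ i → g≤B (suc i)) n) (∣*∣-mono (f (suc n)) (g 0) ℚ.≤-refl (g≤B 0)))

  mean-deviation : ∀ f N → ∣ recip N * Σ₁ f N - f N ∣ ≤ deviation f N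
  mean-deviation f N = begin
    ∣ recip N * Σ₁ f N - f N ∣
      -- `f N` is replaced by the mean of N + 1 copies of itself.
      ≡⟨ cong (λ u → ∣ recip N * Σ₁ f N - u ∣) (sym (trans (cong (_* f N) (recip-nat N)) (ℚ.*-identityˡ (f N)))) ⟩
    ∣ recip N * Σ₁ f N - recip N * nat (suc N) * f N ∣
      ≡⟨ cong ∣_∣ (solve 4 (λ r s n c → r :* s :- r :* n :* c := r :* (s :- n :* c)) refl (recip N) (Σ₁ f N) (nat (suc N)) (f N)) ⟩
    ∣ recip N * (Σ₁ f N - nat (suc N) * f N) ∣
      ≡⟨ cong (λ u → ∣ recip N * u ∣) (sym (centre (suc N))) ⟩
    ∣ recip N * Σ₁ (λ i → f i - f N) N ∣
      ≤⟨ ∣*∣-mono (recip N) _ (∣recip∣≤ N) (∣Σ₀∣≤ (λ i → f i - f N) (suc N)) ⟩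
    deviation f N ∎
    where
    centre : ∀ n → Σ₀ (λ i → f i - f N) n ≡ Σ₀ f n - nat n * f N
    centre zero    = solve 1 (λ c → con 0ℚ := con 0ℚ :- con 0ℚ :* c) refl (f N)
    centre (suc n) = trans (cong (_+ (f n - f N)) (centre n)) (trans
      (solve 4 (λ s n c a → s :- n :* c :+ (a :- c) := s :+ a :- (con 1ℚ :+ n) :* c) refl (Σ₀ f n) (nat n) (f N) (f n))
      (cong (λ u → Σ₁ f n - u * f N) (sym (nat-suc n))))

  -- The convolution is recentred at the last term of g, which leaves one
  -- mean deviation of f and one of g.
  mean-⊛ : ∀ {f g} → Cauchy f → Cauchy g → Vanishing (λ N → recip N * (f ⊛ g) N - f N * g N)
  mean-⊛ {f} {g} F G = Vanishing-cong (λ N → sym (split N))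
    (Vanishing-+ {λ N → recip N * (f ⊛ λ i → g i - g N) N}
      (Vanishing-≤ {λ N → A * deviation g N} left
        (Vanishing-* {λ _ → A} (Bounded-const A) (deviation-vanishing g G)))
      (Vanishing-* {g} (Cauchy⇒Bounded g G)
        (Vanishing-≤ {deviation f} {λ N → recip N * Σ₁ f N - f N} right (deviation-vanishing f F))))
    where
    A = proj₁ (Cauchy⇒Bounded f F)
    0≤A = ℚ.<⇒≤ (proj₁ (proj₂ (Cauchy⇒Bounded f F)))
    f≤A = proj₂ (proj₂ (Cauchy⇒Bounded f F))
    right : ∀ N → ∣ recip N * Σ₁ f N - f N ∣ ≤ ∣ deviation f N ∣
    right N = ℚ.≤-trans (mean-deviation f N) (ℚ.≤-reflexive (sym (ℚ.0≤p⇒∣p∣≡p (0≤deviation f N))))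
    split : ∀ N → recip N * (f ⊛ g) N - f N * g N ≡ recip N * (f ⊛ λ i → g i - g N) N + g N * (recip N * Σ₁ f N - f N)
    split N = trans (cong (λ u → recip N * u - f N * g N)
        (trans (⊛-cong {f} (λ _ → refl) (λ i → solve 2 (λ a b → a := a :- b :+ b) refl (g i) (g N)) N)
          (⊛-+const f (λ i → g i - g N) (g N) N)))
      (solve 5 (λ r a c s x → r :* (a :+ c :* s) :- x :* c := r :* a :+ c :* (r :* s :- x)) refl
        (recip N) ((f ⊛ λ i → g i - g N) N) (g N) (Σ₁ f N) (f N))
    left : ∀ N → ∣ recip N * (f ⊛ λ i → g i - g N) N ∣ ≤ ∣ A * deviation g N ∣
    left N = begin
      ∣ recip N * (f ⊛ λ i → g i - g N) N ∣   ≡⟨ cong (λ u → ∣ recip N * u ∣) (⊛-comm f (λ i → g i - g N) N) ⟩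
      ∣ recip N * ((λ i → g i - g N) ⊛ f) N ∣ ≤⟨ ∣*∣-mono (recip N) _ (∣recip∣≤ N) (∣⊛∣≤ (λ i → g i - g N) f f≤A N) ⟩
      recip N * (Σ₁ (λ i → ∣ g i - g N ∣) N * A)
        ≡⟨ solve 3 (λ r s a → r :* (s :* a) := a :* (r :* s)) refl (recip N) (Σ₁ (λ i → ∣ g i - g N ∣) N) A ⟩
      A * deviation g N                       ≡⟨ ℚ.0≤p⇒∣p∣≡p (0≤* 0≤A (0≤deviation g N)) ⟨
      ∣ A * deviation g N ∣                   ∎

  infix 4 _⟶_

  -- A limit is a Cauchy sequence rather than an element of ℝ, so that
  -- comparing two limits does not compare their proofs of convergence.
  record _⟶_ (f x : ℕ → ℚ) : Set where
    constructor converges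
    field
      difference   : Vanishing (λ n → f n - x n)
      limit-cauchy : Cauchy x
  open _⟶_

  Vanishing-≗ : ∀ {f g} → f ≗ g → Vanishing (λ n → f n - g n)
  Vanishing-≗ {f} {g} p ε 0<ε = 0 , λ n _ →
    subst (_< ε) (sym (cong ∣_∣ (trans (cong (_- g n) (p n)) (ℚ.+-inverseʳ (g n))))) 0<ε

  Cauchy-transfer : ∀ {f x} → Vanishing (λ n → f n - x n) → Cauchy x → Cauchy f
  Cauchy-transfer {f} {x} D X ε 0<ε = M ℕ.⊔ N , λ m n ≤m ≤n → begin-strict
    ∣ f m - f n ∣
      ≡⟨ cong ∣_∣ (solve 4 (λ a b c d → a :- b := (a :- c) :- (b :- d) :+ (c :- d)) refl (f m) (f n) (x m) (x n)) ⟩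
    ∣ (f m - x m) - (f n - x n) + (x m - x n) ∣
      ≤⟨ ∣+∣-mono ((f m - x m) - (f n - x n)) (x m - x n)
           (∣-∣-mono (f m - x m) (f n - x n)
             (ℚ.<⇒≤ (proj₂ (D δ 0<δ) m (ℕ.m⊔n≤o⇒m≤o M N ≤m))) (ℚ.<⇒≤ (proj₂ (D δ 0<δ) n (ℕ.m⊔n≤o⇒m≤o M N ≤n)))) ℚ.≤-refl ⟩
    δ + δ + ∣ x m - x n ∣
      <⟨ ℚ.+-monoʳ-< (δ + δ) (proj₂ (X (½ * ε) (0<* ½-positive 0<ε)) m n (ℕ.m⊔n≤o⇒n≤o M N ≤m) (ℕ.m⊔n≤o⇒n≤o M N ≤n)) ⟩
    δ + δ + ½ * ε
      ≡⟨ solve 1 (λ e → con ½ :* (con ½ :* e) :+ con ½ :* (con ½ :* e) :+ con ½ :* e := e) refl ε ⟩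
    ε ∎
    where
    δ = ½ * (½ * ε)
    0<δ : 0ℚ < δ
    0<δ = 0<* ½-positive (0<* ½-positive 0<ε)
    M = proj₁ (D δ 0<δ)
    N = proj₁ (X (½ * ε) (0<* ½-positive 0<ε))

  ⟶-Cauchy : ∀ {f x} → f ⟶ x → Cauchy f
  ⟶-Cauchy {f} {x} (converges D X) = Cauchy-transfer {f} {x} D X

  ⟶-refl : ∀ {f x} → Cauchy x → f ≗ x → f ⟶ x
  ⟶-refl X p = converges (Vanishing-≗ p) X

  ⟶-cong : ∀ {f g x} → f ≗ g → f ⟶ x → g ⟶ x
  ⟶-cong {x = x} p (converges D X) = converges (Vanishing-cong (λ n → cong (_- x n) (p n)) D) X

  -- A limit is fixed only up to a vanishing difference; this changes its representative.
  ⟶-∼ : ∀ {f x y} → Vanishing (λ n → y n - x n) → f ⟶ x → f ⟶ y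
  ⟶-∼ {f} {x} {y} E (converges D X) = converges (Vanishing-cong
    (λ n → solve 3 (λ f x y → (f :- x) :+ con (- 1ℚ) :* (y :- x) := f :- y) refl (f n) (x n) (y n))
    (Vanishing-+ {λ n → f n - x n} D (Vanishing-* (Bounded-const (- 1ℚ)) E))) (Cauchy-transfer {y} {x} E X)

  ⟶-respʳ : ∀ {f x y} → x ≗ y → f ⟶ x → f ⟶ y
  ⟶-respʳ p = ⟶-∼ (Vanishing-≗ λ n → sym (p n))

  ⟶-unique : ∀ {f x y} → f ⟶ x → f ⟶ y → Vanishing (λ n → x n - y n)
  ⟶-unique {f} {x} {y} (converges D _) (converges E _) = Vanishing-cong
    (λ n → solve 3 (λ f x y → con (- 1ℚ) :* (f :- x) :+ (f :- y) := x :- y) refl (f n) (x n) (y n))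
    (Vanishing-+ (Vanishing-* (Bounded-const (- 1ℚ)) D) E)

  ⟶-+ : ∀ {f g x y} → f ⟶ x → g ⟶ y → f ∔ g ⟶ x ∔ y
  ⟶-+ {f} {g} {x} {y} (converges D X) (converges E Y) = converges (Vanishing-cong
    (λ n → solve 4 (λ f g x y → (f :- x) :+ (g :- y) := (f :+ g) :- (x :+ y)) refl (f n) (g n) (x n) (y n))
    (Vanishing-+ D E))
    (+-cauchy x y X Y)

  ⟶-* : ∀ {f g x y} → f ⟶ x → g ⟶ y → (λ n → f n * g n) ⟶ λ n → x n * y n
  ⟶-* {f} {g} {x} {y} F G = converges (Vanishing-cong
    (λ n → solve 4 (λ f g x y → f :* (g :- y) :+ y :* (f :- x) := f :* g :- x :* y) refl (f n) (g n) (x n) (y n))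
    (Vanishing-+ {λ n → f n * (g n - y n)}
      (Vanishing-* {f} (Cauchy⇒Bounded f (⟶-Cauchy F)) (difference G))
      (Vanishing-* {y} (Cauchy⇒Bounded y (limit-cauchy G)) (difference F))))
    (*-cauchy x y (limit-cauchy F) (limit-cauchy G))

  mean-⊛-⟶ : ∀ {f g x y} → f ⟶ x → g ⟶ y → (λ N → recip N * (f ⊛ g) N) ⟶ λ n → x n * y n
  mean-⊛-⟶ {f} {g} {x} {y} F G = converges (Vanishing-cong
    (λ n → solve 3 (λ a b c → (a :- b) :+ (b :- c) := a :- c) refl (recip n * (f ⊛ g) n) (f n * g n) (x n * y n))
    (Vanishing-+ (mean-⊛ (⟶-Cauchy F) (⟶-Cauchy G)) (difference (⟶-* F G)))) (limit-cauchy (⟶-* F G))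

-- Evaluation at -1 by ordinary and Cesàro summation.

module Evaluation where
  open Defs using (ℝ; plain; bar; partial; ones; ζ; ln2; riemann-1/t; _/_!; 1ℝ; ∑₁; module Convergence)
    renaming (_*_ to _*ℝ_; -_ to -ℝ_; _^_ to _^ℝ_)
  open Defs.ℝ
  open Convergence using (nat; recip; riemann-step; partial-cauchy; riemann-cauchy; const-cauchy)
  open PowerSeries
  open Limits
  open import Data.Rational.Base using (ℚ; 1ℚ; _+_; _*_; _-_; -_; _<_; ∣_∣)
  open import Data.Rational.Solver using (module +-*-Solver)
  open +-*-Solver using (solve; con; _:=_; _:+_; _:*_; _:-_; :-_)
  open RawSemiring ℚ.+-*-rawSemiring using () renaming (_^_ to infixr 9 _^_)
  open ≡-Reasoning

  cesàro : (ℕ → ℚ) → ℕ → ℚ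
  cesàro f N = recip N * Σ₁ (Σ₁ (signed f)) N

  infix 4 _⇓_ _⇓ᶜ_

  _⇓_ _⇓ᶜ_ : (ℕ → ℚ) → (ℕ → ℚ) → Set
  f ⇓ x  = Σ₁ (signed f) ⟶ x
  f ⇓ᶜ x = cesàro f ⟶ x

  -- Partial sums are coefficients after multiplication by 1/(1-t). Both factors 1/(1-t) can be
  -- pulled out, so convolving the partial sums of f and g gives the double running sum for `f ⊛ g`,
  -- whose mean `mean-⊛-⟶` controls.
  ⇓-⊛ : ∀ {f g x y} → f ⇓ x → g ⇓ y → f ⊛ g ⇓ᶜ λ n → x n * y n
  ⇓-⊛ {f} {g} X Y = ⟶-cong (λ N → cong (recip N *_) (eq N)) (mean-⊛-⟶ X Y)
    where
    eq : Σ₁ (signed f) ⊛ Σ₁ (signed g) ≗ Σ₁ (Σ₁ (signed (f ⊛ g)))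
    eq N = begin
      (Σ₁ (signed f) ⊛ Σ₁ (signed g)) N     ≡⟨ ⊛-Σ₁ˡ (signed f) (Σ₁ (signed g)) N ⟩
      Σ₁ (signed f ⊛ Σ₁ (signed g)) N       ≡⟨ Σ₁-cong (⊛-Σ₁ʳ (signed f) (signed g)) N ⟩
      Σ₁ (Σ₁ (signed f ⊛ signed g)) N       ≡⟨ Σ₁-cong (Σ₁-cong (signed-⊛ f g)) N ⟩
      Σ₁ (Σ₁ (signed (f ⊛ g))) N            ∎

  ⇓-cong : ∀ {f g x} → f ≗ g → f ⇓ x → g ⇓ x
  ⇓-cong p = ⟶-cong (Σ₁-cong λ n → cong ((- 1ℚ) ^ n *_) (p n))

  ⇓ᶜ-cong : ∀ {f g x} → f ≗ g → f ⇓ᶜ x → g ⇓ᶜ x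
  ⇓ᶜ-cong p = ⟶-cong λ N → cong (recip N *_) (Σ₁-cong (Σ₁-cong λ n → cong ((- 1ℚ) ^ n *_) (p n)) N)

  Σ₁-signed-· : ∀ c f → Σ₁ (signed (c · f)) ≗ c · Σ₁ (signed f)
  Σ₁-signed-· c f n = trans
    (Σ₁-cong (λ j → solve 3 (λ s c f → s :* (c :* f) := c :* (s :* f)) refl ((- 1ℚ) ^ j) c (f j)) n) (Σ₀-· c (signed f) (suc n))

  Σ₁-signed-∔ : ∀ f g → Σ₁ (signed (f ∔ g)) ≗ Σ₁ (signed f) ∔ Σ₁ (signed g)
  Σ₁-signed-∔ f g n = trans (Σ₁-cong (λ j → ℚ.*-distribˡ-+ ((- 1ℚ) ^ j) (f j) (g j)) n) (Σ₀-∔ (signed f) (signed g) (suc n))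

  const⟶ : ∀ c → (λ _ → c) ⟶ λ _ → c
  const⟶ c = ⟶-refl (const-cauchy c) λ _ → refl

  ⇓-· : ∀ c {f x} → f ⇓ x → c · f ⇓ c · x
  ⇓-· c {f} X = ⟶-cong (λ n → sym (Σ₁-signed-· c f n)) (⟶-* (const⟶ c) X)

  ⇓ᶜ-· : ∀ c {f x} → f ⇓ᶜ x → c · f ⇓ᶜ c · x
  ⇓ᶜ-· c {f} X = ⟶-cong eq (⟶-* (const⟶ c) X)
    where
    eq : c · cesàro f ≗ cesàro (c · f)
    eq N = begin
      c * (recip N * Σ₁ (Σ₁ (signed f)) N)   ≡⟨ solve 3 (λ c r s → c :* (r :* s) := r :* (c :* s)) refl c (recip N) (Σ₁ (Σ₁ (signed f)) N) ⟩
      recip N * (c * Σ₁ (Σ₁ (signed f)) N)   ≡⟨ cong (recip N *_) (Σ₀-· c (Σ₁ (signed f)) (suc N)) ⟨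
      recip N * Σ₁ (c · Σ₁ (signed f)) N     ≡⟨ cong (recip N *_) (Σ₁-cong (Σ₁-signed-· c f) N) ⟨
      recip N * Σ₁ (Σ₁ (signed (c · f))) N   ∎

  ⇓ᶜ-∔ : ∀ {f g x y} → f ⇓ᶜ x → g ⇓ᶜ y → f ∔ g ⇓ᶜ x ∔ y
  ⇓ᶜ-∔ {f} {g} X Y = ⟶-cong eq (⟶-+ X Y)
    where
    F = Σ₁ (signed f)
    G = Σ₁ (signed g)
    eq : cesàro f ∔ cesàro g ≗ cesàro (f ∔ g)
    eq N = begin
      recip N * Σ₁ F N + recip N * Σ₁ G N    ≡⟨ ℚ.*-distribˡ-+ (recip N) (Σ₁ F N) (Σ₁ G N) ⟨
      recip N * (Σ₁ F N + Σ₁ G N)            ≡⟨ cong (recip N *_) (Σ₀-∔ F G (suc N)) ⟨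
      recip N * Σ₁ (F ∔ G) N                 ≡⟨ cong (recip N *_) (Σ₁-cong (Σ₁-signed-∔ f g) N) ⟨
      recip N * Σ₁ (Σ₁ (signed (f ∔ g))) N   ∎

  Li-[]-⇓ : Li [] ⇓ λ _ → 1ℚ
  Li-[]-⇓ = ⟶-refl (const-cauchy 1ℚ) λ n → trans (Σ₁-cong drop-sign n) (Σ₁-Li [] n)
    where
    drop-sign : signed (Li []) ≗ Li []
    drop-sign zero    = refl
    drop-sign (suc n) = ℚ.*-zeroʳ ((- 1ℚ) ^ suc n)

  -- Multiplying by the constant series 1, which sums to 1, makes the regularity of Cesàro means a
  -- case of `⇓-⊛`.
  ⇓⇒⇓ᶜ : ∀ {f x} → f ⇓ x → f ⇓ᶜ x
  ⇓⇒⇓ᶜ {f} {x} X = ⟶-respʳ (λ n → ℚ.*-identityʳ (x n)) (⇓ᶜ-cong (⊛-identityʳ f) (⇓-⊛ X Li-[]-⇓))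

  Li-⇓ : ∀ s .{{_ : NonZero s}} es → Li (plain s ∷ es) ⇓ partial (bar s ∷ es)
  Li-⇓ s es = ⟶-refl (partial-cauchy (bar s ∷ es) _) (Σ₁-signed-Li s es)

  -- H(2n) - H(n) is the alternating harmonic sum up to 2n: both grow by 1/(2n+1) - 1/(2n+2) from n
  -- to n + 1.
  riemann≡-partial : ∀ n → riemann-1/t n ≡ - partial (bar 1 ∷ []) (n ℕ.+ n)
  riemann≡-partial zero    = refl
  riemann≡-partial (suc n) = begin
    riemann-1/t (suc n)
      ≡⟨ solve 2 (λ a b → a := (a :- b) :+ b) refl (riemann-1/t (suc n)) (riemann-1/t n) ⟩
    (riemann-1/t (suc n) - riemann-1/t n) + riemann-1/t n
      ≡⟨ cong₂ _+_ (riemann-step n) (riemann≡-partial n) ⟩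
    (recip (n ℕ.+ n) - recip (suc (n ℕ.+ n))) + - L (n ℕ.+ n)
      ≡⟨ solve 3 (λ a b l → (a :- b) :+ :- l
           := :- (l :+ con (- 1ℚ) :* con 1ℚ :* (a :* con 1ℚ) :* con 1ℚ :+ con (- 1ℚ) :* (con (- 1ℚ) :* con 1ℚ) :* (b :* con 1ℚ) :* con 1ℚ))
           refl (recip (n ℕ.+ n)) (recip (suc (n ℕ.+ n))) (L (n ℕ.+ n)) ⟩
    - (L (n ℕ.+ n) + (- 1ℚ) * 1ℚ * (recip (n ℕ.+ n) * 1ℚ) * 1ℚ + (- 1ℚ) * ((- 1ℚ) * 1ℚ) * (recip (suc (n ℕ.+ n)) * 1ℚ) * 1ℚ)
      -- Only (-1)^(2n) has to be evaluated; the next two signs unfold from it.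
      ≡⟨ cong (λ s → - (L (n ℕ.+ n) + (- 1ℚ) * s * (recip (n ℕ.+ n) * 1ℚ) * 1ℚ
           + (- 1ℚ) * ((- 1ℚ) * s) * (recip (suc (n ℕ.+ n)) * 1ℚ) * 1ℚ)) (even n) ⟨
    - L (suc (suc (n ℕ.+ n)))
      ≡⟨ cong (λ i → - L (suc i)) (ℕ.+-suc n n) ⟨
    - L (suc n ℕ.+ suc n) ∎
    where
    L = partial (bar 1 ∷ [])
    even : ∀ n → (- 1ℚ) ^ (n ℕ.+ n) ≡ 1ℚ
    even zero    = refl
    even (suc n) = trans (cong (λ i → - 1ℚ * (- 1ℚ) ^ i) (ℕ.+-suc n n)) (cong (λ s → - 1ℚ * (- 1ℚ * s)) (even n))

  -- The Riemann sums are the partial sums at even indices, so the Cauchy property at indices 2n and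
  -- n suffices.
  P±1-⇓ : P± 1 ⇓ riemann-1/t
  P±1-⇓ = converges (λ ε 0<ε → proj₁ (C ε 0<ε) , λ n N≤n → subst (_< ε) (cong ∣_∣ (sym (eq n)))
    (proj₂ (C ε 0<ε) (n ℕ.+ n) n (ℕ.≤-trans N≤n (ℕ.m≤m+n n n)) N≤n)) riemann-cauchy
    where
    L = partial (bar 1 ∷ [])
    C = partial-cauchy (bar 1 ∷ []) _
    eq : ∀ n → Σ₁ (signed (P± 1)) n - riemann-1/t n ≡ L (n ℕ.+ n) - L n
    eq n = trans (cong₂ _-_ (trans (Σ₁-signed-· (- 1ℚ * 1ℚ) (Li (ones 1)) n) (cong (- 1ℚ * 1ℚ *_) (Σ₁-signed-Li 1 [] n))) (riemann≡-partial n))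
      (solve 2 (λ a b → con (- 1ℚ) :* con 1ℚ :* a :- (:- b) := b :- a) refl (L n) (L (n ℕ.+ n)))

  unit-fraction-* : ∀ m n .{{_ : NonZero m}} .{{_ : NonZero n}} .{{_ : NonZero (m ℕ.* n)}} →
    ℤ.+ 1 ℚ./ (m ℕ.* n) ≡ (ℤ.+ 1 ℚ./ m) * (ℤ.+ 1 ℚ./ n)
  unit-fraction-* (suc m) (suc n) = ℚ.toℚᵘ-injective (ℚᵘ.≃-trans (ℚ.toℚᵘ-fromℚᵘ (ℚᵘ.mkℚᵘ (ℤ.+ 1) _))
    (ℚᵘ.≃-sym (ℚᵘ.≃-trans (ℚ.toℚᵘ-homo-* (recip m) (recip n))
      (ℚᵘ.*-cong (ℚ.toℚᵘ-fromℚᵘ (ℚᵘ.mkℚᵘ (ℤ.+ 1) m)) (ℚ.toℚᵘ-fromℚᵘ (ℚᵘ.mkℚᵘ (ℤ.+ 1) n))))))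

  -- The recursion x^(i+1)/(i+1)! = x (x^i/i!)/(i+1) for x = ln(1-t); `recip i` is 1/(i+1).
  P±-⊛ : ∀ i → recip i · (P± 1 ⊛ P± i) ≗ P± (suc i)
  P±-⊛ i n = begin
    recip i * (P± 1 ⊛ P± i) n
      ≡⟨ cong (recip i *_) (trans (⊛-·ˡ (- 1ℚ * 1ℚ) (Li (ones 1)) (P± i) n) (cong (- 1ℚ * 1ℚ *_) (⊛-·ʳ s (Li (ones 1)) (Li (ones i)) n))) ⟩
    recip i * (- 1ℚ * 1ℚ * (s * (Li (ones 1) ⊛ Li (ones i)) n))
      ≡⟨ cong (λ u → recip i * (- 1ℚ * 1ℚ * (s * u))) (ones-⊛ i n) ⟩
    recip i * (- 1ℚ * 1ℚ * (s * (nat (suc i) * P)))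
      ≡⟨ solve 4 (λ r s k p → r :* (con (- 1ℚ) :* con 1ℚ :* (s :* (k :* p))) := r :* (k :* (con (- 1ℚ) :* s :* p))) refl (recip i) s (nat (suc i)) P ⟩
    recip i * (nat (suc i) * (- 1ℚ * s * P))
      ≡⟨ recip-nat-cancel i (- 1ℚ * s * P) ⟩
    P± (suc i) n ∎
    where
    s = (- 1ℚ) ^ i
    P = Li (ones (suc i)) n

  ln2^/! : ℕ → ℕ → ℚ
  ln2^/! i = seq (ln2 ^ℝ i / i !)

  ln2^/!-suc : ∀ i n → recip i * (riemann-1/t n * ln2^/! i n) ≡ ln2^/! (suc i) n
  ln2^/!-suc i n = trans
    (solve 4 (λ r l p f → r :* (l :* (p :* f)) := (l :* p) :* (r :* f)) refl (recip i) (riemann-1/t n) (seq (ln2 ^ℝ i) n) ((ℤ.+ 1 ℚ./ i !) {{i !≢0}}))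
    (cong (riemann-1/t n * seq (ln2 ^ℝ i) n *_) (sym (unit-fraction-* (suc i) (i !) {{_}} {{i !≢0}} {{suc i !≢0}})))

  -- `partial-cauchy` gives convergence without the value, and `P±-⊛` gives the value, but only for
  -- the Cesàro means. Uniqueness of limits combines the two.
  P±-⇓ : ∀ i → P± i ⇓ ln2^/! i
  P±-⇓ zero    = ⟶-respʳ (λ _ → refl) (⇓-· 1ℚ Li-[]-⇓)
  P±-⇓ (suc i) = ⟶-∼ (⟶-unique cesàro-limit (⇓⇒⇓ᶜ direct-limit)) direct-limit
    where
    direct-limit : P± (suc i) ⇓ (- 1ℚ) ^ suc i · partial (bar 1 ∷ ones i)
    direct-limit = ⇓-· ((- 1ℚ) ^ suc i) (Li-⇓ 1 (ones i))
    cesàro-limit : P± (suc i) ⇓ᶜ ln2^/! (suc i)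
    cesàro-limit = ⇓ᶜ-cong (P±-⊛ i) (⟶-respʳ (ln2^/!-suc i) (⇓ᶜ-· (recip i) (⇓-⊛ P±1-⇓ (P±-⇓ i))))

  -- For j = 0 the leading entry would be 3, a case left to `antipode-⇓ᶜ`. The form `j ∸ 1` matches
  -- the strings in `term`.
  Q-⇓ : ∀ k j → 0 ℕ.< j → Q k j ⇓ partial (bar 1 ∷ ones (j ∸ 1) ++ plain 3 ∷ ones k)
  Q-⇓ k (suc j) _ = Li-⇓ 1 (ones j ++ plain 3 ∷ ones k)

  -- Keeps the shape of the theorem, since comparing reals of different
  -- shapes makes Agda unfold their proofs of convergence.
  term : ℕ → ℕ → ℕ → ℝ
  term m k i = (ln2 ^ℝ i / i !) *ℝ ζ (bar 1 ∷ ones (m ∸ i ∸ 1) ++ plain 3 ∷ ones (k ∸ 1))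

  -- Values of the antipode sums at -1.

  module _ (m k : ℕ) where
    -- The summand at index 0 is kept apart because it belongs to the left side of the theorem;
    -- those from 1 on form its finite sum.
    antipode-value : ℕ → ℕ → ℚ
    antipode-value i = partial (bar 1 ∷ ones m ++ plain 3 ∷ ones k) ∔ seq (∑₁ i (term (suc m) (suc k)))

    antipode-partial-⇓ᶜ : ∀ i → i ℕ.≤ m → antipode (suc m) k i ⇓ᶜ antipode-value i
    antipode-partial-⇓ᶜ zero _ = ⟶-respʳ
      (λ n → trans (ℚ.*-identityˡ (head n)) (sym (ℚ.+-identityʳ (head n))))
      (⇓-⊛ (P±-⇓ 0) (Li-⇓ 1 (ones m ++ plain 3 ∷ ones k)))
      where head = partial (bar 1 ∷ ones m ++ plain 3 ∷ ones k)
    antipode-partial-⇓ᶜ (suc i) i<m = ⟶-respʳ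
      (λ n → ℚ.+-assoc (partial (bar 1 ∷ ones m ++ plain 3 ∷ ones k) n) (seq (∑₁ i (term (suc m) (suc k))) n) (seq (term (suc m) (suc k) (suc i)) n))
      (⇓ᶜ-∔ (antipode-partial-⇓ᶜ i (ℕ.<⇒≤ i<m)) (⇓-⊛ (P±-⇓ (suc i)) (Q-⇓ k (m ∸ i) (ℕ.m<n⇒0<n∸m i<m))))

    antipode-⇓ᶜ : antipode (suc m) k (suc m) ⇓ᶜ antipode-value m ∔ λ n → ln2^/! (suc m) n * partial (bar 3 ∷ ones k) n
    antipode-⇓ᶜ = ⇓ᶜ-∔ (antipode-partial-⇓ᶜ m ℕ.≤-refl)
      -- At the last index `Q` is `Q k (m ∸ m)`, whose string starts with 3; this is the source of
      -- the value with leading `bar 3`.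
      (⇓-⊛ (P±-⇓ (suc m)) (⇓-cong (λ n → cong (λ j → Q k j n) (sym (ℕ.n∸n≡0 m))) (Li-⇓ 3 (ones k))))

  seq-sign : ∀ i n → seq ((-ℝ 1ℝ) ^ℝ i) n ≡ (- 1ℚ) ^ i
  seq-sign zero    n = refl
  seq-sign (suc i) n = cong (- 1ℚ *_) (seq-sign i n)

  -- The sign is kept as a power in ℝ, as in the theorem, so that the final comparison needs no
  -- conversion.
  signed-antipode : ℕ → ℕ → ℕ → ℚ
  signed-antipode m k n = seq ((-ℝ 1ℝ) ^ℝ suc m) n * (antipode-value m k m n + ln2^/! (suc m) n * partial (bar 3 ∷ ones k) n)

  signed-antipode-⇓ᶜ : ∀ m k → (- 1ℚ) ^ suc m · antipode (suc m) k (suc m) ⇓ᶜ signed-antipode m k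
  signed-antipode-⇓ᶜ m k = ⟶-respʳ
    (λ n → cong (_* (antipode-value m k m n + ln2^/! (suc m) n * partial (bar 3 ∷ ones k) n)) (sym (seq-sign (suc m) n)))
    (⇓ᶜ-· ((- 1ℚ) ^ suc m) (antipode-⇓ᶜ m k))

  -- The two sides of `antipode-symmetrised` are one series, so their Cesàro values agree.
  antipode-values : ∀ m k → Vanishing λ n →
    signed-antipode m k n + signed-antipode k m n - partial (bar 2 ∷ ones m) n * partial (bar 2 ∷ ones k) n
  antipode-values m k = ⟶-unique
    (⇓ᶜ-cong (antipode-symmetrised m k) (⇓ᶜ-∔ (signed-antipode-⇓ᶜ m k) (signed-antipode-⇓ᶜ k m)))
    (⇓-⊛ (Li-⇓ 2 (ones m)) (Li-⇓ 2 (ones k)))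

  -- The letters stand, in consecutive pairs, for the signs, the left-hand zeta values, the inverse
  -- factorials, the powers of ln 2, the values with leading `bar 3`, the finite sums, and the
  -- values with leading `bar 2`.
  rearrange : ∀ s t z₁ z₂ f g l h c d S₁ S₂ a b →
    s * (z₁ + S₁ + l * f * c) + t * (z₂ + S₂ + h * g * d) - a * b
    ≡ (s * z₁ + t * z₂)
      - ((- 1ℚ * s) * f * l * c + (- 1ℚ * t) * g * h * d + a * b + (- 1ℚ * s) * S₁ + (- 1ℚ * t) * S₂)
  rearrange = solve 14 (λ s t z₁ z₂ f g l h c d S₁ S₂ a b →
    s :* (z₁ :+ S₁ :+ l :* f :* c) :+ t :* (z₂ :+ S₂ :+ h :* g :* d) :- a :* b
    := (s :* z₁ :+ t :* z₂)
      :- ((con (- 1ℚ) :* s) :* f :* l :* c :+ (con (- 1ℚ) :* t) :* g :* h :* d :+ a :* b :+ (con (- 1ℚ) :* s) :* S₁ :+ (con (- 1ℚ) :* t) :* S₂))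
    refl

open import Defs
open Evaluation using (antipode-values; rearrange; term)

theorem2p4 : (m k : ℕ) .{{_ : NonZero m}} .{{_ : NonZero k}} →
    (- 1ℝ) ^ m * ζ (bar 1 ∷ ones (m ∸ 1) ++ plain 3 ∷ ones (k ∸ 1))
    + (- 1ℝ) ^ k * ζ (bar 1 ∷ ones (k ∸ 1) ++ plain 3 ∷ ones (m ∸ 1))
    ≈ (- 1ℝ) ^ suc m / m ! * ln2 ^ m * ζ (bar 3 ∷ ones (k ∸ 1))
    + (- 1ℝ) ^ suc k / k ! * ln2 ^ k * ζ (bar 3 ∷ ones (m ∸ 1))
    + ζ (bar 2 ∷ ones (m ∸ 1)) * ζ (bar 2 ∷ ones (k ∸ 1))
    + (- 1ℝ) ^ suc m * (∑[1≤ i ≤ m ∸ 1 ] (ln2 ^ i / i ! * ζ (bar 1 ∷ ones (m ∸ i ∸ 1) ++ plain 3 ∷ ones (k ∸ 1))))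
    + (- 1ℝ) ^ suc k * (∑[1≤ i ≤ k ∸ 1 ] (ln2 ^ i / i ! * ζ (bar 1 ∷ ones (k ∸ i ∸ 1) ++ plain 3 ∷ ones (m ∸ 1))))
theorem2p4 zero    _       {{m≢0}}         = contradiction-irr m≢0 λ ()
theorem2p4 (suc m) zero    {{_}} {{k≢0}}   = contradiction-irr k≢0 λ ()
theorem2p4 (suc m) (suc k) = Limits.Vanishing-cong
  (λ n → rearrange (seq ((- 1ℝ) ^ suc m) n) (seq ((- 1ℝ) ^ suc k) n)
    (partial (bar 1 ∷ ones m ++ plain 3 ∷ ones k) n) (partial (bar 1 ∷ ones k ++ plain 3 ∷ ones m) n)
    ((ℤ.+ 1 ℚ./ suc m !) {{suc m !≢0}}) ((ℤ.+ 1 ℚ./ suc k !) {{suc k !≢0}}) (seq (ln2 ^ suc m) n) (seq (ln2 ^ suc k) n)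
    (partial (bar 3 ∷ ones k) n) (partial (bar 3 ∷ ones m) n)
    (seq (∑₁ m (term (suc m) (suc k))) n) (seq (∑₁ k (term (suc k) (suc m))) n)
    (partial (bar 2 ∷ ones m) n) (partial (bar 2 ∷ ones k) n))
  (antipode-values m k)
  where open ℝ
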